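{- Let $\mathcal{CS}$ be a variant closed and axiomatically appropriate constant specification for FOJT45. For every closed formula $\varphi$ of the basic FOJT45 language, if $\varphi$ is valid in every Fitting model for FOJT45 meeting $\mathcal{CS}$, then $\vdash_{\mathcal{CS}}\varphi$ in $\mathsf{FOJT45}$.
   Context: Syntax of FOJT45: terms $t::=p_i\mid c\mid (t\cdot t)\mid(t+t)\mid !t\mid ?t\mid\mathsf{gen}_x(t)$; formulas $Px_1\dots x_n\mid\bot\mid\varphi\to\varphi\mid\forall x\varphi\mid t{:}_X\varphi$, $X$ a finite set of individual variables, with $fv(t{:}_X\psi)=X$. $Xy=X\cup\{y\}$, $y\notin X$. Axioms: A1 classical first-order; A2 $t{:}_{Xy}\varphi\to t{:}_X\varphi$ ($y$ not free in $\varphi$); A3 $t{:}_X\varphi\to t{:}_{Xy}\varphi$; B1 $t{:}_X\varphi\to\varphi$; B2 $t{:}_X(\varphi\to\psi)\to(s{:}_X\varphi\to[t\cdot s]{:}_X\psi)$; B3 $t{:}_X\varphi\to[t+s]{:}_X\varphi$, $s{:}_X\varphi\to[t+s]{:}_X\varphi$; B4 $t{:}_X\varphi\to!t{:}_Xt{:}_X\varphi$; B5 $t{:}_X\varphi\to\mathsf{gen}_x(t){:}_X\forall x\varphi$ ($x\notin X$); B6 $\neg t{:}_X\varphi\to ?t{:}_X\neg t{:}_X\varphi$; rules MP and generalization. A constant specification $\mathcal{CS}$ is a set of $c{:}\psi$ with $\psi$ an axiom, added as axioms; axiomatically appropriate if every axiom gets some constant; variant closed if $c{:}\varphi\in\mathcal{CS}$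 iff $c{:}\psi\in\mathcal{CS}$ whenever $\varphi,\psi$ differ by a one-to-one onto renaming of free individual variables. Semantics. $\mathcal D$-formulas: formulas with elements of a nonempty set $\mathcal D$ substituted for free variable occurrences; closed if no free variables remain. A Fitting model for FOJT45 $\langle\mathcal W,\mathcal R,\mathcal D,\mathcal I,\mathcal E\rangle$: $\mathcal W\ne\emptyset$, $\mathcal R$ an equivalence relation on $\mathcal W$, $\mathcal I(P,w)\subseteq\mathcal D^n$, $\mathcal E(t,\varphi)\subseteq\mathcal W$ with $\mathcal E(t,\varphi\to\psi)\cap\mathcal E(s,\varphi)\subseteq\mathcal E(t\cdot s,\psi)$; $\mathcal E(s,\varphi)\cup\mathcal E(t,\varphi)\subseteq\mathcal E(s+t,\varphi)$; $\mathcal E(t,\varphi)\subseteq\mathcal E(!t,t{:}_X\varphi)$ for $X\subseteq\mathcal D$ containing the elements of $\varphi$; $\mathcal R$-upward closure of $\mathcal E(t,\varphi)$; $\mathcal E(t,\varphi(x))\subseteq\mathcal E(t,\varphi(a))$ for $a\in\mathcal D$; $\mathcal E(t,\varphi)\subseteq\mathcal E(\mathsf{gen}_x(t),\forall x\varphi)$; strong evidence $\mathcal E(t,\varphi)\subseteq\{w:w\Vdash t{:}_X\varphi\}$ and $\mathcal W\setminus\mathcal E(t,\varphi)\subseteq\mathcal E(?t,\neg t{:}_X\varphi)$, $X$ the set of domain elements in $\varphi$. Truth: atomic via $\mathcal I$; $\bot$ false; $\to$ classical; $\forall x\psi$ iff $\psi(a)$ for all $a$; $w\Vdash t{:}_X\psi(\vec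 x)$ ($\vec x$ the free variables of $\psi$) iff $w\in\mathcal E(t,\psi(\vec x))$ and $w'\Vdash\psi(\vec a)$ for all $\mathcal R$-successors $w'$ and all $\vec a$. Meets $\mathcal{CS}$: $\mathcal E(c,\varphi)=\mathcal W$ for $c{:}\varphi\in\mathcal{CS}$. Valid: true at every world. -}

module Defs where

open import Data.Bool using (if_then_else_)
open import Data.Empty using (⊥; ⊥-elim)
open import Data.List using (List; []; _∷_; _++_; map)
open import Data.List.Membership.Propositional using (_∈_; _∉_)
open import Data.List.Relation.Binary.Subset.Propositional using (_⊆_)
open import Data.List.Relation.Unary.Any using (any?)
open import Data.Maybe using (Maybe; maybe′)
open import Data.Nat using (ℕ)
open import Data.Nat.Properties using (_≟_)
open import Data.Product using (Σ; ∃; ∃-syntax; _×_; _,_)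
open import Data.Sum using (_⊎_)
open import Data.Unit using (⊤)
open import Data.Vec as Vec using (Vec)
import Data.Vec.Membership.Propositional as Vec
open import Function using (_∘_; _⇔_; _↔_; mk⇔; Equivalence; Inverse; Injective)
open import Relation.Binary using (IsEquivalence)
open import Relation.Binary.PropositionalEquality
  using (_≡_; _≢_; refl; sym; cong; cong₂; subst)
open import Relation.Nullary using (¬_; Dec; yes; no; does)

Var : Set
Var = ℕ

infixl 8 _·_
infixl 7 _⊕_

data Tm : Set where
  p    : ℕ → Tm
  con  : ℕ → Tm
  _·_  : Tm → Tm → Tm
  _⊕_  : Tm → Tm → Tm
  !_   : Tm → Tm
  ⁇_   : Tm → Tm
  gen  : Var → Tm → Tm

-- A countable (possibly finite) supply of predicate symbols.
record Signature : Set₁ where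
  field
    Pred           : Set
    arity          : Pred → ℕ
    code           : Pred → ℕ
    code-injective : Injective _≡_ _≡_ code

data Ind (D : Set) : Set where
  var  : Var → Ind D
  elem : D → Ind D

var≟ : ∀ {D} (x : Var) (u : Ind D) → Dec (var x ≡ u)
var≟ x (elem a) = no λ ()
var≟ x (var y) with x ≟ y
... | yes refl = yes refl
... | no x≢y   = no λ { refl → x≢y refl }

var∈? : ∀ {D} (x : Var) (X : List (Ind D)) → Dec (var x ∈ X)
var∈? x = any? (var≟ x)

elemsI : ∀ {D} → Ind D → List D
elemsI (var x)  = []
elemsI (elem a) = a ∷ []

elemsL : ∀ {D} → List (Ind D) → List D
elemsL []      = []
elemsL (u ∷ X) = elemsI u ++ elemsL X

mapInd : ∀ {D D′} → (D → D′) → Ind D → Ind D′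
mapInd f (var x)  = var x
mapInd f (elem a) = elem (f a)

Subst : Set → Set
Subst D = Var → Ind D

applyI : ∀ {D} → Subst D → Ind D → Ind D
applyI σ (var x)  = σ x
applyI σ (elem a) = elem a

_∖_ : ∀ {D} → Subst D → Var → Subst D
(σ ∖ x) y = if does (x ≟ y) then var y else σ y

_↾_ : ∀ {D} → Subst D → List (Ind D) → Subst D
(σ ↾ X) y = if does (var∈? y X) then σ y else var y

_↦_ : ∀ {D} → Var → Ind D → Subst D
(x ↦ u) y = if does (x ≟ y) then u else var y

-- Truth of a closed ∀xφ refers to the truth of φ(a), which is not a subterm of
-- ∀xφ.  Substitution preserves the shape, so truth is defined by recursion on it.
data Shape : Set where
  leaf : Shape
  bin  : Shape → Shape → Shape
  un   : Shape → Shape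

module FOJT45 (S : Signature) where
  open Signature S public

  infix  9 _∶⟨_⟩_
  infixr 6 _⊃_
  infix  4 _≈_

  -- Formulas over variables and elements of D.  In t ∶⟨ X ⟩ φ the list X stands
  -- for the finite set of its members: formulas are identified up to _≈_ below.
  data Fml (D : Set) : Set where
    atom    : (P : Pred) → Vec (Ind D) (arity P) → Fml D
    bot     : Fml D
    _⊃_     : Fml D → Fml D → Fml D
    all     : Var → Fml D → Fml D
    _∶⟨_⟩_  : Tm → List (Ind D) → Fml D → Fml D

  neg : ∀ {D} → Fml D → Fml D
  neg φ = φ ⊃ bot

  -- The basic language.
  Formula : Set
  Formula = Fml ⊥

  data _≈_ {D : Set} : Fml D → Fml D → Set where
    atom : ∀ {P us} → atom P us ≈ atom P us
    bot  : bot ≈ bot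
    _⊃_  : ∀ {φ φ′ ψ ψ′} → φ ≈ φ′ → ψ ≈ ψ′ → φ ⊃ ψ ≈ φ′ ⊃ ψ′
    all  : ∀ {x φ φ′} → φ ≈ φ′ → all x φ ≈ all x φ′
    just : ∀ {t X X′ φ φ′} → X ⊆ X′ → X′ ⊆ X → φ ≈ φ′ →
           t ∶⟨ X ⟩ φ ≈ t ∶⟨ X′ ⟩ φ′

  Free : ∀ {D} → Ind D → Fml D → Set
  Free u (atom P us)    = u Vec.∈ us
  Free u bot            = ⊥
  Free u (φ ⊃ ψ)        = Free u φ ⊎ Free u ψ
  Free u (all x φ)      = u ≢ var x × Free u φ
  Free u (t ∶⟨ X ⟩ φ)   = u ∈ X

  Closed : ∀ {D} → Fml D → Set
  Closed φ = ∀ x → ¬ Free (var x) φ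

  -- Occurrences in φ of variables outside X are bound in t ∶⟨ X ⟩ φ.
  infixl 10 _[_]
  _[_] : ∀ {D} → Fml D → Subst D → Fml D
  atom P us    [ σ ] = atom P (Vec.map (applyI σ) us)
  bot          [ σ ] = bot
  (φ ⊃ ψ)      [ σ ] = φ [ σ ] ⊃ ψ [ σ ]
  all x φ      [ σ ] = all x (φ [ σ ∖ x ])
  (t ∶⟨ X ⟩ φ) [ σ ] = t ∶⟨ map (applyI σ) X ⟩ (φ [ σ ↾ X ])

  -- No clash of variables.  In t ∶⟨ X ⟩ φ the individual put for a member of X
  -- must not be a variable of φ that is bound by t ∶⟨ X ⟩.
  FreeFor : ∀ {D} → Subst D → Fml D → Set
  FreeFor σ (atom P us)  = ⊤
  FreeFor σ bot          = ⊤
  FreeFor σ (φ ⊃ ψ)      = FreeFor σ φ × FreeFor σ ψ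
  FreeFor σ (all x φ)    =
    (∀ y → Free (var y) (all x φ) → σ y ≢ var x) × FreeFor (σ ∖ x) φ
  FreeFor σ (t ∶⟨ X ⟩ φ) =
    (∀ y → var y ∈ X → Free (σ y) φ → σ y ∈ X) × FreeFor (σ ↾ X) φ

  -- The axiom schemes; the basic system is the case D = ⊥, where every Ind D is
  -- a variable.
  data Axiom {D : Set} : Fml D → Set where
    A1-K : ∀ {φ ψ} → Axiom (φ ⊃ ψ ⊃ φ)
    A1-S : ∀ {φ ψ χ} → Axiom ((φ ⊃ ψ ⊃ χ) ⊃ (φ ⊃ ψ) ⊃ φ ⊃ χ)
    A1-N : ∀ {φ} → Axiom (neg (neg φ) ⊃ φ)
    A1-I : ∀ {x u φ} → FreeFor (x ↦ u) φ → Axiom (all x φ ⊃ φ [ x ↦ u ])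
    A1-D : ∀ {x φ ψ} → ¬ Free (var x) φ →
           Axiom (all x (φ ⊃ ψ) ⊃ φ ⊃ all x ψ)
    A2   : ∀ {t X y φ} → y ∉ X → ¬ Free y φ →
           Axiom (t ∶⟨ y ∷ X ⟩ φ ⊃ t ∶⟨ X ⟩ φ)
    A3   : ∀ {t X y φ} → y ∉ X → Axiom (t ∶⟨ X ⟩ φ ⊃ t ∶⟨ y ∷ X ⟩ φ)
    B1   : ∀ {t X φ} → Axiom (t ∶⟨ X ⟩ φ ⊃ φ)
    B2   : ∀ {t s X φ ψ} →
           Axiom (t ∶⟨ X ⟩ (φ ⊃ ψ) ⊃ s ∶⟨ X ⟩ φ ⊃ (t · s) ∶⟨ X ⟩ ψ)
    B3ˡ  : ∀ {t s X φ} → Axiom (t ∶⟨ X ⟩ φ ⊃ (t ⊕ s) ∶⟨ X ⟩ φ)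
    B3ʳ  : ∀ {t s X φ} → Axiom (s ∶⟨ X ⟩ φ ⊃ (t ⊕ s) ∶⟨ X ⟩ φ)
    B4   : ∀ {t X φ} → Axiom (t ∶⟨ X ⟩ φ ⊃ (! t) ∶⟨ X ⟩ (t ∶⟨ X ⟩ φ))
    B5   : ∀ {t x X φ} → var x ∉ X →
           Axiom (t ∶⟨ X ⟩ φ ⊃ gen x t ∶⟨ X ⟩ all x φ)
    B6   : ∀ {t X φ} →
           Axiom (neg (t ∶⟨ X ⟩ φ) ⊃ (⁇ t) ∶⟨ X ⟩ neg (t ∶⟨ X ⟩ φ))
    ≈-ax : ∀ {φ ψ} → φ ≈ ψ → Axiom φ → Axiom ψ

  record ConstantSpecification : Set₁ where
    field
      Has   : ℕ → Formula → Set
      axiom : ∀ {c ψ} → Has c ψ → Axiom ψ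
      ≈-has : ∀ {c φ ψ} → φ ≈ ψ → Has c φ → Has c ψ

  open ConstantSpecification public using (Has)

  AxiomaticallyAppropriate : ConstantSpecification → Set
  AxiomaticallyAppropriate CS = ∀ ψ → Axiom ψ → ∃[ c ] Has CS c ψ

  -- A bijection between the free variables of two formulas extends to a
  -- permutation of all variables.
  Variant : Formula → Formula → Set
  Variant φ ψ = Σ (Var ↔ Var) λ ρ →
    let σ = var ∘ Inverse.to ρ in FreeFor σ φ × (φ [ σ ] ≈ ψ)

  VariantClosed : ConstantSpecification → Set
  VariantClosed CS = ∀ φ ψ → Variant φ ψ → ∀ c → Has CS c φ ⇔ Has CS c ψ

  infix 3 _⊢_
  data _⊢_ (CS : ConstantSpecification) : Formula → Set where
    ax  : ∀ {φ} → Axiom φ → CS ⊢ φ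
    cs  : ∀ {c ψ} → Has CS c ψ → CS ⊢ con c ∶⟨ [] ⟩ ψ
    mp  : ∀ {φ ψ} → CS ⊢ φ ⊃ ψ → CS ⊢ φ → CS ⊢ ψ
    gnl : ∀ {x φ} → CS ⊢ φ → CS ⊢ all x φ

  mapFml : ∀ {D D′} → (D → D′) → Fml D → Fml D′
  mapFml f (atom P us)  = atom P (Vec.map (mapInd f) us)
  mapFml f bot          = bot
  mapFml f (φ ⊃ ψ)      = mapFml f φ ⊃ mapFml f ψ
  mapFml f (all x φ)    = all x (mapFml f φ)
  mapFml f (t ∶⟨ X ⟩ φ) = t ∶⟨ map (mapInd f) X ⟩ mapFml f φ

  embed : ∀ {D} → Formula → Fml D
  embed = mapFml ⊥-elim

  -- Not every Fml D arises by substitution into a basic formula: an element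
  -- occurring in φ must belong to X in t ∶⟨ X ⟩ φ.
  IsDFormula : ∀ {D} → Fml D → Set
  IsDFormula {D} δ = Σ Formula λ φ → Σ (Var → Maybe D) λ σ →
    δ ≈ embed φ [ (λ x → maybe′ elem (var x) (σ x)) ]

  elems : ∀ {D} → Fml D → List D
  elems (atom P us)  = elemsL (Vec.toList us)
  elems bot          = []
  elems (φ ⊃ ψ)      = elems φ ++ elems ψ
  elems (all x φ)    = elems φ
  elems (t ∶⟨ X ⟩ φ) = elemsL X ++ elems φ

  _∶_ : ∀ {D} → Tm → Fml D → Fml D
  t ∶ φ = t ∶⟨ map elem (elems φ) ⟩ φ

  shape : ∀ {D} → Fml D → Shape
  shape (atom P us)  = leaf
  shape bot          = leaf
  shape (φ ⊃ ψ)      = bin (shape φ) (shape ψ)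
  shape (all x φ)    = un (shape φ)
  shape (t ∶⟨ X ⟩ φ) = un (shape φ)

  shape-[] : ∀ {D} (φ : Fml D) σ → shape (φ [ σ ]) ≡ shape φ
  shape-[] (atom P us)  σ = refl
  shape-[] bot          σ = refl
  shape-[] (φ ⊃ ψ)      σ = cong₂ bin (shape-[] φ σ) (shape-[] ψ σ)
  shape-[] (all x φ)    σ = cong un (shape-[] φ (σ ∖ x))
  shape-[] (t ∶⟨ X ⟩ φ) σ = cong un (shape-[] φ (σ ↾ X))

  record Structure : Set₁ where
    field
      W : Set
      R : W → W → Set
      D : Set
      I : (P : Pred) → W → Vec D (arity P) → Set
      E : Tm → Fml D → W → Set

    Truth : Shape → W → Fml D → Set
    Truth leaf      w (atom P us)  = ∃[ as ] us ≡ Vec.map elem as × I P w as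
    Truth leaf      w bot          = ⊥
    Truth (bin s r) w (φ ⊃ ψ)      = Truth s w φ → Truth r w ψ
    Truth (un s)    w (all x φ)    = (a : D) → Truth s w (φ [ x ↦ elem a ])
    Truth (un s)    w (t ∶⟨ X ⟩ φ) =
      E t φ w ×
      (∀ w′ → R w w′ → (as : Var → D) → Truth s w′ (φ [ elem ∘ as ]))
    Truth _         w _            = ⊥

    infix 3 _⊩_
    _⊩_ : W → Fml D → Set
    w ⊩ φ = Truth (shape φ) w φ

    private
      reshape : ∀ {w} φ σ → Truth (shape φ) w (φ [ σ ]) ⇔ (w ⊩ φ [ σ ])
      reshape {w} φ σ = mk⇔
        (subst (λ s → Truth s w (φ [ σ ])) (sym (shape-[] φ σ)))
        (subst (λ s → Truth s w (φ [ σ ])) (shape-[] φ σ))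

    open Equivalence

    ⊩-⊃ : ∀ {w φ ψ} → (w ⊩ φ ⊃ ψ) ⇔ ((w ⊩ φ) → (w ⊩ ψ))
    ⊩-⊃ = mk⇔ (λ f → f) (λ f → f)

    ⊩-all : ∀ {w x φ} → (w ⊩ all x φ) ⇔ ((a : D) → w ⊩ φ [ x ↦ elem a ])
    ⊩-all {φ = φ} = mk⇔
      (λ h a → to (reshape φ _) (h a))
      (λ h a → from (reshape φ _) (h a))

    ⊩-∶ : ∀ {w t X φ} → (w ⊩ t ∶⟨ X ⟩ φ) ⇔
      (E t φ w × (∀ w′ → R w w′ → (as : Var → D) → w′ ⊩ φ [ elem ∘ as ]))
    ⊩-∶ {φ = φ} = mk⇔
      (λ (e , h) → e , λ w′ r as → to (reshape φ _) (h w′ r as))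
      (λ (e , h) → e , λ w′ r as → from (reshape φ _) (h w′ r as))

  record FittingModel : Set₁ where
    field
      structure : Structure
    open Structure structure public
    field
      world    : W
      element  : D
      R-equiv  : IsEquivalence R
      -- E is a function of the formula, hence insensitive to how sets are listed.
      E-resp   : ∀ {t φ ψ w} → IsDFormula φ → φ ≈ ψ → E t φ w → E t ψ w
      E-app    : ∀ {t s φ ψ w} → IsDFormula (φ ⊃ ψ) →
                 E t (φ ⊃ ψ) w → E s φ w → E (t · s) ψ w
      E-sum    : ∀ {s t φ w} → IsDFormula φ →
                 E s φ w ⊎ E t φ w → E (s ⊕ t) φ w
      E-bang   : ∀ {t φ w} → IsDFormula φ → (X : List D) → elems φ ⊆ X →
                 E t φ w → E (! t) (t ∶⟨ map elem X ⟩ φ) w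
      E-R      : ∀ {t φ w w′} → IsDFormula φ → R w w′ → E t φ w → E t φ w′
      E-inst   : ∀ {t φ w} → IsDFormula φ → ∀ x a →
                 E t φ w → E t (φ [ x ↦ elem a ]) w
      E-gen    : ∀ {t φ w} → IsDFormula φ → ∀ x →
                 E t φ w → E (gen x t) (all x φ) w
      E-strong : ∀ {t φ w} → IsDFormula φ → E t φ w → w ⊩ t ∶ φ
      E-query  : ∀ {t φ w} → IsDFormula φ → ¬ E t φ w → E (⁇ t) (neg (t ∶ φ)) w

  Meets : FittingModel → ConstantSpecification → Set
  Meets M CS = ∀ c φ → Has CS c φ → ∀ w → E (con c) (embed φ) w
    where open FittingModel M

  ValidIn : FittingModel → Formula → Set
  ValidIn M φ = ∀ w → w ⊩ embed φ
    where open FittingModel M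

{-# OPTIONS --safe #-}
module Submission where

-- One world suffices.  Since E(t, φ) may be read off a maximal consistent set Γ
-- as t:φ ∈ Γ, a justification formula outside Γ fails for lack of evidence, and
-- no second world has to be found to refute it.  Γ is a Henkin set of formulas
-- with elements of ℕ, containing the negation of the unprovable formula; an
-- element a is read in the basic language as the variable N + a, for all large N.
-- A2 and A3 let X in t:_X φ be changed freely as long as it keeps the free
-- elements of φ, so E does not depend on X.  The strong evidence condition holds
-- because t:_X φ → t:_Xa φ(a) is provable for x ∉ X by A3, generalization and
-- instantiation, and B1 then gives every instance of φ.

open import Axiom.ExcludedMiddle using (ExcludedMiddle)
open import Level using (0ℓ)
open import Defs

open import Data.Bool using (true; false)
open import Data.Empty using (⊥; ⊥-elim)
open import Data.List using (List; []; _∷_; _++_; map)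
open import Data.List.Membership.Propositional using (_∈_; _∉_)
open import Data.List.Membership.Propositional.Properties
  using (∈-map⁺; ∈-map⁻; ∈-++⁺ˡ; ∈-++⁺ʳ; ∈-++⁻)
import Data.List.Properties as List
open import Data.List.Relation.Binary.Subset.Propositional using (_⊆_)
open import Data.List.Relation.Binary.Subset.Propositional.Properties using (++⁺; map⁺)
open import Data.List.Relation.Unary.All as All using ()
open import Data.List.Relation.Unary.Any using (here; there)
open import Data.Nat using (ℕ; zero; suc; _+_; _⊔_; _≤_; _<_; _<?_; ⌊_/2⌋)
open import Data.Nat.Properties
open import Data.Product using (Σ; ∃-syntax; _×_; _,_; proj₁; proj₂)
open import Data.Sum using (_⊎_; inj₁; inj₂; [_,_]′)
import Data.Sum as Sum
open import Data.Unit using (⊤; tt)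
open import Data.Vec as Vec using (Vec; []; _∷_)
import Data.Vec.Membership.Propositional as Vec
import Data.Vec.Membership.Propositional.Properties as Vec
import Data.Vec.Properties as Vec
open import Data.Vec.Relation.Unary.Any using (here; there)
open import Function using (_∘_; _⇔_; mk⇔; Equivalence)
open import Relation.Binary using (tri<; tri≈; tri>)
open import Relation.Binary.PropositionalEquality
  using (_≡_; _≢_; refl; sym; trans; cong; cong₂; subst)
open import Relation.Nullary using (¬_; Dec; yes; no; does; proof; ofʸ; ofⁿ; contradiction)

-- Auxiliary facts on vectors and lists.

vec-∈-map⁻ : ∀ {A B : Set} (f : A → B) {n y} (xs : Vec A n) →
             y Vec.∈ Vec.map f xs → ∃[ x ] x Vec.∈ xs × y ≡ f x
vec-∈-map⁻ f (x ∷ xs) (here eq) = x , here refl , eq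
vec-∈-map⁻ f (x ∷ xs) (there m) with vec-∈-map⁻ f xs m
... | x′ , m′ , eq = x′ , there m′ , eq

vec-map-cong-local : ∀ {A B : Set} {f g : A → B} {n} (xs : Vec A n) →
                     (∀ x → x Vec.∈ xs → f x ≡ g x) → Vec.map f xs ≡ Vec.map g xs
vec-map-cong-local []       h = refl
vec-map-cong-local (x ∷ xs) h =
  cong₂ _∷_ (h x (here refl)) (vec-map-cong-local xs (λ y m → h y (there m)))

list-map-cong-local : ∀ {A B : Set} {f g : A → B} (xs : List A) →
                      (∀ x → x ∈ xs → f x ≡ g x) → map f xs ≡ map g xs
list-map-cong-local xs h = List.map-cong-local (All.tabulate (h _))

fresh : (l : List ℕ) → ∃[ a ] a ∉ l
fresh l = suc (max l) , λ m → 1+n≰n (bounded m)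
  where
  max : List ℕ → ℕ
  max []      = 0
  max (a ∷ l) = a ⊔ max l

  bounded : ∀ {a l} → a ∈ l → a ≤ max l
  bounded {l = b ∷ l} (here refl) = m≤m⊔n b (max l)
  bounded {l = b ∷ l} (there m)   = ≤-trans (bounded m) (m≤n⊔m b (max l))

-- Substitution

module _ {D : Set} where

  var-injective : ∀ {x y} → var {D} x ≡ var y → x ≡ y
  var-injective refl = refl

  ∖-same : ∀ (σ : Subst D) x → (σ ∖ x) x ≡ var x
  ∖-same σ x with does (x ≟ x) | proof (x ≟ x)
  ... | true | ofʸ _  = refl
  ... | false | ofⁿ x≢x = contradiction refl x≢x

  ∖-other : ∀ (σ : Subst D) {x y} → x ≢ y → (σ ∖ x) y ≡ σ y
  ∖-other σ {x} {y} x≢y with does (x ≟ y) | proof (x ≟ y)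
  ... | true | ofʸ x≡y = contradiction x≡y x≢y
  ... | false | ofⁿ _    = refl

  ↾-∈ : ∀ (σ : Subst D) {X y} → var y ∈ X → (σ ↾ X) y ≡ σ y
  ↾-∈ σ {X} {y} m with var∈? y X
  ... | yes _ = refl
  ... | no ¬m = contradiction m ¬m

  ↾-∉ : ∀ (σ : Subst D) {X y} → var y ∉ X → (σ ↾ X) y ≡ var y
  ↾-∉ σ {X} {y} ¬m with var∈? y X
  ... | yes m = contradiction m ¬m
  ... | no _  = refl

  ↦-same : ∀ x (u : Ind D) → (x ↦ u) x ≡ u
  ↦-same x u with does (x ≟ x) | proof (x ≟ x)
  ... | true | ofʸ _  = refl
  ... | false | ofⁿ x≢x = contradiction refl x≢x

  ↦-other : ∀ {x y} (u : Ind D) → x ≢ y → (x ↦ u) y ≡ var y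
  ↦-other {x} {y} u x≢y with does (x ≟ y) | proof (x ≟ y)
  ... | true | ofʸ x≡y = contradiction x≡y x≢y
  ... | false | ofⁿ _    = refl

  ∈-elemsL⁺ : ∀ {a : D} {X} → elem a ∈ X → a ∈ elemsL X
  ∈-elemsL⁺ (here refl)             = here refl
  ∈-elemsL⁺ {X = u ∷ X} (there m)   = ∈-++⁺ʳ (elemsI u) (∈-elemsL⁺ m)

  ∈-elemsL⁻ : ∀ {a : D} X → a ∈ elemsL X → elem a ∈ X
  ∈-elemsL⁻ (var x ∷ X)  m           = there (∈-elemsL⁻ X m)
  ∈-elemsL⁻ (elem b ∷ X) (here refl) = here refl
  ∈-elemsL⁻ (elem b ∷ X) (there m)   = there (∈-elemsL⁻ X m)

  applyI-cong : ∀ {σ τ : Subst D} u → (∀ y → var y ≡ u → σ y ≡ τ y) →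
                applyI σ u ≡ applyI τ u
  applyI-cong (var x)  h = h x refl
  applyI-cong (elem a) h = refl

  all-elem : ∀ {n} (us : Vec (Ind D) n) → (∀ x → ¬ var x Vec.∈ us) →
             ∃[ as ] us ≡ Vec.map elem as
  all-elem []            h = [] , refl
  all-elem (var x ∷ us)  h = contradiction (here refl) (h x)
  all-elem (elem a ∷ us) h with all-elem us (λ x → h x ∘ there)
  ... | as , e = a ∷ as , cong (elem a ∷_) e

  -- Raising `k` by one costs a single substitution, so an assignment to all free variables of a
  -- formula is reached in finitely many instantiations.
  upto : (Var → D) → ℕ → Subst D
  upto as k y with y <? k
  ... | yes _ = elem (as y)
  ... | no _  = var y

  upto-< : ∀ as {k y} → y < k → upto as k y ≡ elem (as y)
  upto-< as {k} {y} y<k with y <? k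
  ... | yes _ = refl
  ... | no ≮  = contradiction y<k ≮

  upto-≥ : ∀ as {k y} → k ≤ y → upto as k y ≡ var y
  upto-≥ as {k} {y} k≤y with y <? k
  ... | yes y<k = contradiction k≤y (<⇒≱ y<k)
  ... | no _    = refl

  upto-suc : ∀ as k y → applyI (k ↦ elem (as k)) (upto as k y) ≡ upto as (suc k) y
  upto-suc as k y with <-cmp y k
  ... | tri< y<k _ _ rewrite upto-< as y<k | upto-< as (m<n⇒m<1+n y<k) = refl
  ... | tri≈ _ refl _ rewrite upto-≥ as (≤-refl {k}) | upto-< as (n<1+n k) =
    ↦-same k (elem (as k))
  ... | tri> _ k≢y k<y rewrite upto-≥ as (<⇒≤ k<y) | upto-≥ as k<y =
    ↦-other {x = k} (elem (as k)) λ { refl → k≢y refl }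

bin-injective : ∀ {s r s′ r′} → bin s r ≡ bin s′ r′ → s ≡ s′ × r ≡ r′
bin-injective refl = refl , refl

un-injective : ∀ {s s′} → un s ≡ un s′ → s ≡ s′
un-injective refl = refl

-- Set-listing equivalence, substitution and variable capture.

module Syntax (S : Signature) where
  open FOJT45 S

  ≈-refl : ∀ {D} {φ : Fml D} → φ ≈ φ
  ≈-refl {φ = atom P us}  = atom
  ≈-refl {φ = bot}        = bot
  ≈-refl {φ = φ ⊃ ψ}      = ≈-refl ⊃ ≈-refl
  ≈-refl {φ = all x φ}    = all ≈-refl
  ≈-refl {φ = t ∶⟨ X ⟩ φ} = just (λ m → m) (λ m → m) ≈-refl

  ≈-sym : ∀ {D} {φ ψ : Fml D} → φ ≈ ψ → ψ ≈ φ
  ≈-sym atom         = atom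
  ≈-sym bot          = bot
  ≈-sym (e ⊃ f)      = ≈-sym e ⊃ ≈-sym f
  ≈-sym (all e)      = all (≈-sym e)
  ≈-sym (just i j e) = just j i (≈-sym e)

  elems-≈ : ∀ {D} {φ ψ : Fml D} → φ ≈ ψ → elems φ ⊆ elems ψ
  elems-≈ atom m         = m
  elems-≈ bot m          = m
  elems-≈ (e ⊃ f) m      = ++⁺ (elems-≈ e) (elems-≈ f) m
  elems-≈ (all e) m      = elems-≈ e m
  elems-≈ (just {X = X} i _ e) m =
    ++⁺ (λ n → ∈-elemsL⁺ (i (∈-elemsL⁻ X n))) (elems-≈ e) m

  Free-≈ : ∀ {D} {φ ψ : Fml D} {u} → φ ≈ ψ → Free u φ → Free u ψ
  Free-≈ atom f                = f
  Free-≈ (e ⊃ e′) (inj₁ f)     = inj₁ (Free-≈ e f)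
  Free-≈ (e ⊃ e′) (inj₂ f)     = inj₂ (Free-≈ e′ f)
  Free-≈ (all e) (u≢x , f)     = u≢x , Free-≈ e f
  Free-≈ (just i _ e) f        = i f

  Free-elem⇒∈elems : ∀ {D} {a : D} φ → Free (elem a) φ → a ∈ elems φ
  Free-elem⇒∈elems (atom P us)  m        = ∈-elemsL⁺ (Vec.∈-toList⁺ m)
  Free-elem⇒∈elems (φ ⊃ ψ)      (inj₁ f) = ∈-++⁺ˡ (Free-elem⇒∈elems φ f)
  Free-elem⇒∈elems (φ ⊃ ψ)      (inj₂ f) = ∈-++⁺ʳ (elems φ) (Free-elem⇒∈elems ψ f)
  Free-elem⇒∈elems (all x φ)    (_ , f)  = Free-elem⇒∈elems φ f
  Free-elem⇒∈elems (t ∶⟨ X ⟩ φ) m        = ∈-++⁺ˡ (∈-elemsL⁺ m)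

  []-cong : ∀ {D} (φ : Fml D) {σ τ} → (∀ y → Free (var y) φ → σ y ≡ τ y) →
            φ [ σ ] ≡ φ [ τ ]
  []-cong (atom P us) h = cong (atom P)
    (vec-map-cong-local us λ u m → applyI-cong u λ { y refl → h y m })
  []-cong bot h = refl
  []-cong (φ ⊃ ψ) h =
    cong₂ _⊃_ ([]-cong φ λ y f → h y (inj₁ f)) ([]-cong ψ λ y f → h y (inj₂ f))
  []-cong (all x φ) {σ} {τ} h = cong (all x) ([]-cong φ eq)
    where
    eq : ∀ y → Free (var y) φ → (σ ∖ x) y ≡ (τ ∖ x) y
    eq y f with does (x ≟ y) | proof (x ≟ y)
    ... | true | ofʸ _  = refl
    ... | false | ofⁿ x≢y = h y ((λ e → x≢y (sym (var-injective e))) , f)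
  []-cong (t ∶⟨ X ⟩ φ) {σ} {τ} h = cong₂ (t ∶⟨_⟩_)
    (list-map-cong-local X λ u m → applyI-cong u λ { y refl → h y m })
    ([]-cong φ eq)
    where
    eq : ∀ y → Free (var y) φ → (σ ↾ X) y ≡ (τ ↾ X) y
    eq y f with var∈? y X
    ... | yes m = h y m
    ... | no _  = refl

  []-id : ∀ {D} (φ : Fml D) {σ} → (∀ y → Free (var y) φ → σ y ≡ var y) → φ [ σ ] ≡ φ
  []-id φ h = trans ([]-cong φ h) (id φ)
    where
    applyI-var : ∀ {D} (u : Ind D) → applyI var u ≡ u
    applyI-var (var x)  = refl
    applyI-var (elem a) = refl

    id : ∀ {D} (φ : Fml D) → φ [ var ] ≡ φ
    id (atom P us)  = cong (atom P) (trans (Vec.map-cong applyI-var us) (Vec.map-id us))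
    id bot          = refl
    id (φ ⊃ ψ)      = cong₂ _⊃_ (id φ) (id ψ)
    id (all x φ)    = cong (all x) (trans ([]-cong φ eq) (id φ))
      where
      eq : ∀ y → Free (var y) φ → (var ∖ x) y ≡ var y
      eq y _ with does (x ≟ y) | proof (x ≟ y)
      ... | true | ofʸ _ = refl
      ... | false | ofⁿ _  = refl
    id (t ∶⟨ X ⟩ φ) = cong₂ (t ∶⟨_⟩_)
      (trans (List.map-cong applyI-var X) (List.map-id X))
      (trans ([]-cong φ eq) (id φ))
      where
      eq : ∀ y → Free (var y) φ → (var ↾ X) y ≡ var y
      eq y _ with var∈? y X
      ... | yes _ = refl
      ... | no _  = refl

  Free-[]⁻ : ∀ {D} (φ : Fml D) {σ w} → Free w (φ [ σ ]) →
             ∃[ u ] Free u φ × w ≡ applyI σ u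
  Free-[]⁻ (atom P us) m = vec-∈-map⁻ _ us m
  Free-[]⁻ (φ ⊃ ψ) (inj₁ f) with Free-[]⁻ φ f
  ... | u , g , e = u , inj₁ g , e
  Free-[]⁻ (φ ⊃ ψ) (inj₂ f) with Free-[]⁻ ψ f
  ... | u , g , e = u , inj₂ g , e
  Free-[]⁻ (all x φ) {σ} (w≢x , f) with Free-[]⁻ φ f
  ... | elem a , g , e = elem a , ((λ ()) , g) , e
  ... | var y , g , e with does (x ≟ y) | proof (x ≟ y)
  ...   | true | ofʸ refl = contradiction e w≢x
  ...   | false | ofⁿ x≢y   = var y , ((λ e′ → x≢y (sym (var-injective e′))) , g) , e
  Free-[]⁻ (t ∶⟨ X ⟩ φ) {σ} m = ∈-map⁻ (applyI σ) m

  -- Below a binder `τ` is cut down to what stays free after `σ`. `FreeFor` ensures that under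
  -- `all x` the cut spares every variable put in by `σ`, and that under `t ∶⟨ X ⟩` no originally
  -- bound variable of `φ` becomes subject to `τ`.
  []-∘ : ∀ {D} (φ : Fml D) {σ τ} → FreeFor σ φ →
         φ [ σ ] [ τ ] ≡ φ [ applyI τ ∘ σ ]
  []-∘ (atom P us) {σ} {τ} _ =
    cong (atom P) (trans (sym (Vec.map-∘ _ _ us)) (Vec.map-cong applyI-∘ us))
    where
    applyI-∘ : ∀ u → applyI τ (applyI σ u) ≡ applyI (applyI τ ∘ σ) u
    applyI-∘ (var x)  = refl
    applyI-∘ (elem a) = refl
  []-∘ bot _ = refl
  []-∘ (φ ⊃ ψ) (p₁ , p₂) = cong₂ _⊃_ ([]-∘ φ p₁) ([]-∘ ψ p₂)
  []-∘ (all x φ) {σ} {τ} (h , p₁) = cong (all x) (trans ([]-∘ φ p₁) ([]-cong φ eq))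
    where
    eq : ∀ y → Free (var y) φ → applyI (τ ∖ x) ((σ ∖ x) y) ≡ ((applyI τ ∘ σ) ∖ x) y
    eq y f with does (x ≟ y) | proof (x ≟ y)
    ... | true | ofʸ refl = ∖-same τ x
    ... | false | ofⁿ x≢y   = applyI-cong (σ y) λ z e → ∖-other τ λ x≡z →
      h y ((λ e′ → x≢y (sym (var-injective e′))) , f) (trans (sym e) (cong var (sym x≡z)))
  []-∘ (t ∶⟨ X ⟩ φ) {σ} {τ} (h , p₁) = cong₂ (t ∶⟨_⟩_)
    (trans (sym (List.map-∘ X)) (List.map-cong applyI-∘ X))
    (trans ([]-∘ φ p₁) ([]-cong φ eq))
    where
    applyI-∘ : ∀ u → applyI τ (applyI σ u) ≡ applyI (applyI τ ∘ σ) u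
    applyI-∘ (var x)  = refl
    applyI-∘ (elem a) = refl

    eq : ∀ y → Free (var y) φ →
         applyI (τ ↾ map (applyI σ) X) ((σ ↾ X) y) ≡ ((applyI τ ∘ σ) ↾ X) y
    eq y f with var∈? y X
    ... | yes m = applyI-cong (σ y) λ z e →
      ↾-∈ τ (subst (_∈ map (applyI σ) X) (sym e) (∈-map⁺ (applyI σ) m))
    ... | no ¬m = ↾-∉ τ captured
      where
      captured : var y ∉ map (applyI σ) X
      captured m with ∈-map⁻ (applyI σ) m
      ... | var v , v∈X , e =
        ¬m (subst (_∈ X) (sym e) (h v v∈X (subst (λ u → Free u φ) e f)))

  -- A free variable of `φ [ σ ]` comes from some free `v`, and `τ` sends it back to `v`, which was
  -- not bound at that place. Hence a renaming can be undone without capture.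
  FreeFor-leftInverse : ∀ {D} (φ : Fml D) {σ τ} → FreeFor σ φ →
    (∀ v → Free (var v) φ → applyI τ (σ v) ≡ var v) → FreeFor τ (φ [ σ ])
  FreeFor-leftInverse (atom P us) _ inv = tt
  FreeFor-leftInverse bot _ inv = tt
  FreeFor-leftInverse (φ ⊃ ψ) (p₁ , p₂) inv =
    FreeFor-leftInverse φ p₁ (λ v f → inv v (inj₁ f)) ,
    FreeFor-leftInverse ψ p₂ (λ v f → inv v (inj₂ f))
  FreeFor-leftInverse (all x φ) {σ} {τ} (h , p₁) inv =
    noCapture , FreeFor-leftInverse φ p₁ inv′
    where
    noCapture : ∀ w → Free (var w) (all x φ [ σ ]) → τ w ≢ var x
    noCapture w f e with Free-[]⁻ (all x φ) {σ} f
    ... | var v , g@(v≢x , _) , e′ =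
      v≢x (trans (sym (inv v g)) (trans (cong (applyI τ) (sym e′)) e))

    inv′ : ∀ v → Free (var v) φ → applyI (τ ∖ x) ((σ ∖ x) v) ≡ var v
    inv′ v f with does (x ≟ v) | proof (x ≟ v)
    ... | true | ofʸ refl = ∖-same τ x
    ... | false | ofⁿ x≢v   = trans
      (applyI-cong (σ v) λ z e → ∖-other τ λ x≡z → h v g (trans (sym e) (cong var (sym x≡z))))
      (inv v g)
      where
      g : Free (var v) (all x φ)
      g = (λ e → x≢v (sym (var-injective e))) , f
  FreeFor-leftInverse (t ∶⟨ X ⟩ φ) {σ} {τ} (h , p₁) inv =
    noCapture , FreeFor-leftInverse φ p₁ inv′
    where
    noCapture : ∀ w → var w ∈ map (applyI σ) X → Free (τ w) (φ [ σ ↾ X ]) →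
                τ w ∈ map (applyI σ) X
    noCapture w m f with ∈-map⁻ (applyI σ) m
    ... | var v , v∈X , e with trans (cong (applyI τ) e) (inv v v∈X)
    ...   | e′ with Free-[]⁻ φ (subst (λ u → Free u (φ [ σ ↾ X ])) e′ f)
    ...     | var v′ , g , e″ with var∈? v′ X
    -- An occurrence of `v` in the substituted body was either put in for some `v′` in `X`, and then
    -- lies in the new set, or was `v` itself, untouched although it belongs to `X`, which is
    -- impossible.
    ...       | yes m′ = subst (_∈ map (applyI σ) X) (sym (trans e′ e″)) (∈-map⁺ (applyI σ) m′)
    ...       | no ¬m′ = contradiction (subst (_∈ X) e″ v∈X) ¬m′

    inv′ : ∀ v → Free (var v) φ → applyI (τ ↾ map (applyI σ) X) ((σ ↾ X) v) ≡ var v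
    inv′ v f with var∈? v X
    ... | yes m = trans
      (applyI-cong (σ v) λ z e →
        ↾-∈ τ (subst (_∈ map (applyI σ) X) (sym e) (∈-map⁺ (applyI σ) m)))
      (inv v m)
    ... | no ¬m = ↾-∉ τ captured
      where
      captured : var v ∉ map (applyI σ) X
      captured m with ∈-map⁻ (applyI σ) m
      ... | var w , w∈X , e =
        ¬m (subst (_∈ X) (sym e) (h w w∈X (subst (λ u → Free u φ) e f)))

  -- u may be put for any free variable of φ without being captured.
  Stable : ∀ {D} → Ind D → Fml D → Set
  Stable u (atom P us)  = ⊤
  Stable u bot          = ⊤
  Stable u (φ ⊃ ψ)      = Stable u φ × Stable u ψ
  Stable u (all x φ)    = u ≢ var x × Stable u φ
  Stable u (t ∶⟨ X ⟩ φ) = (Free u φ → u ∈ X) × Stable u φ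

  FreeFor-stable : ∀ {D} (φ : Fml D) {σ} → (∀ y → σ y ≡ var y ⊎ Stable (σ y) φ) →
                   FreeFor σ φ
  FreeFor-stable (atom P us) h = tt
  FreeFor-stable bot h = tt
  FreeFor-stable (φ ⊃ ψ) h =
    FreeFor-stable φ (Sum.map₂ proj₁ ∘ h) , FreeFor-stable ψ (Sum.map₂ proj₂ ∘ h)
  FreeFor-stable (all x φ) {σ} h = noCapture , FreeFor-stable φ h′
    where
    noCapture : ∀ y → Free (var y) (all x φ) → σ y ≢ var x
    noCapture y (y≢x , _) with h y
    ... | inj₁ e       = λ e′ → y≢x (trans (sym e) e′)
    ... | inj₂ (s , _) = s

    h′ : ∀ y → (σ ∖ x) y ≡ var y ⊎ Stable ((σ ∖ x) y) φ
    h′ y with does (x ≟ y) | proof (x ≟ y)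
    ... | true | ofʸ _ = inj₁ refl
    ... | false | ofⁿ _  = Sum.map₂ proj₂ (h y)
  FreeFor-stable (t ∶⟨ X ⟩ φ) {σ} h = noCapture , FreeFor-stable φ h′
    where
    noCapture : ∀ y → var y ∈ X → Free (σ y) φ → σ y ∈ X
    noCapture y m f with h y
    ... | inj₁ e       = subst (_∈ X) (sym e) m
    ... | inj₂ (s , _) = s f

    h′ : ∀ y → (σ ↾ X) y ≡ var y ⊎ Stable ((σ ↾ X) y) φ
    h′ y with var∈? y X
    ... | yes _ = Sum.map₂ proj₂ (h y)
    ... | no _  = inj₁ refl

  FreeFor-↦ : ∀ {D} (φ : Fml D) x {u} → Stable u φ → FreeFor (x ↦ u) φ
  FreeFor-↦ φ x {u} s = FreeFor-stable φ h
    where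
    h : ∀ y → (x ↦ u) y ≡ var y ⊎ Stable ((x ↦ u) y) φ
    h y with does (x ≟ y) | proof (x ≟ y)
    ... | true | ofʸ _ = inj₂ s
    ... | false | ofⁿ _  = inj₁ refl

  FreeFor-upto : ∀ {D} {φ : Fml D} → (∀ a → Stable (elem a) φ) → ∀ as k → FreeFor (upto as k) φ
  FreeFor-upto {φ = φ} s as k = FreeFor-stable φ h
    where
    h : ∀ y → upto as k y ≡ var y ⊎ Stable (upto as k y) φ
    h y with y <? k
    ... | yes _ = inj₂ (s (as y))
    ... | no _  = inj₁ refl

  Stable-≈ : ∀ {D} {φ ψ : Fml D} {u} → φ ≈ ψ → Stable u φ → Stable u ψ
  Stable-≈ atom s               = tt
  Stable-≈ bot s                = tt
  Stable-≈ (e ⊃ e′) (s , s′)    = Stable-≈ e s , Stable-≈ e′ s′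
  Stable-≈ (all e) (u≢x , s)    = u≢x , Stable-≈ e s
  Stable-≈ (just i _ e) (h , s) = (λ f → i (h (Free-≈ (≈-sym e) f))) , Stable-≈ e s

  ∉elems⇒Stable : ∀ {D} {a : D} (φ : Fml D) → a ∉ elems φ → Stable (elem a) φ
  ∉elems⇒Stable (atom P us) n  = tt
  ∉elems⇒Stable bot n          = tt
  ∉elems⇒Stable (φ ⊃ ψ) n      =
    ∉elems⇒Stable φ (n ∘ ∈-++⁺ˡ) , ∉elems⇒Stable ψ (n ∘ ∈-++⁺ʳ (elems φ))
  ∉elems⇒Stable (all x φ) n    = (λ ()) , ∉elems⇒Stable φ n
  ∉elems⇒Stable (t ∶⟨ X ⟩ φ) n =
    (λ f → contradiction (∈-++⁺ʳ (elemsL X) (Free-elem⇒∈elems φ f)) n) ,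
    ∉elems⇒Stable φ (n ∘ ∈-++⁺ʳ (elemsL X))

  -- Under `t ∶⟨ X ⟩` only members of `X` are replaced, and their replacements enter the new set, so
  -- a newly placed element is listed there as well.
  Stable-[] : ∀ {D} {a : D} (φ : Fml D) {σ} → Stable (elem a) φ → Stable (elem a) (φ [ σ ])
  Stable-[] (atom P us) s        = tt
  Stable-[] bot s                = tt
  Stable-[] (φ ⊃ ψ) (s , s′)     = Stable-[] φ s , Stable-[] ψ s′
  Stable-[] (all x φ) (_ , s)    = (λ ()) , Stable-[] φ s
  Stable-[] {a = a} (t ∶⟨ X ⟩ φ) {σ} (h , s) = h′ , Stable-[] φ s
    where
    h′ : Free (elem a) (φ [ σ ↾ X ]) → elem a ∈ map (applyI σ) X
    h′ f with Free-[]⁻ φ f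
    ... | elem b , g , refl = ∈-map⁺ (applyI σ) (h g)
    ... | var y , g , e with var∈? y X
    ...   | yes m = subst (_∈ map (applyI σ) X) (sym e) (∈-map⁺ (applyI σ) m)

  elems-embed : ∀ {D} φ → elems (embed {D} φ) ≡ []
  elems-embed (atom P us)  = vars us
    where
    vars : ∀ {n D} (us : Vec (Ind ⊥) n) →
           elemsL (Vec.toList (Vec.map (mapInd {D′ = D} ⊥-elim) us)) ≡ []
    vars []           = refl
    vars (var x ∷ us) = vars us
  elems-embed bot          = refl
  elems-embed (φ ⊃ ψ)      = cong₂ _++_ (elems-embed φ) (elems-embed ψ)
  elems-embed (all x φ)    = elems-embed φ
  elems-embed (t ∶⟨ X ⟩ φ) = cong₂ _++_ (vars X) (elems-embed φ)
    where
    vars : ∀ {D} X → elemsL (map (mapInd {D′ = D} ⊥-elim) X) ≡ []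
    vars []          = refl
    vars (var x ∷ X) = vars X

  Closed-↦ : ∀ {D x} {φ : Fml D} → Closed (all x φ) → ∀ a → Closed (φ [ x ↦ elem a ])
  Closed-↦ {x = x} {φ} c a y f with Free-[]⁻ φ f
  ... | var v , g , e with does (x ≟ v) | proof (x ≟ v)
  ...   | false | ofⁿ x≢v = c v ((λ e′ → x≢v (sym (var-injective e′))) , g)

  Closed-elem : ∀ {D} (φ : Fml D) (as : Var → D) → Closed (φ [ elem ∘ as ])
  Closed-elem φ as y f with Free-[]⁻ φ f
  ... | var v , _ , ()
  ... | elem a , _ , ()

  Closed-embed : ∀ {D} φ → Closed φ → Closed (embed {D} φ)
  Closed-embed φ c x f = c x (Free-embed⁻ φ f)
    where
    Free-embed⁻ : ∀ {D x} φ → Free (var x) (embed {D} φ) → Free (var x) φ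
    Free-embed⁻ (atom P us) m with vec-∈-map⁻ _ us m
    ... | var y , m′ , refl = m′
    Free-embed⁻ (φ ⊃ ψ) (inj₁ f) = inj₁ (Free-embed⁻ φ f)
    Free-embed⁻ (φ ⊃ ψ) (inj₂ f) = inj₂ (Free-embed⁻ ψ f)
    Free-embed⁻ (all y φ) (x≢y , f) = (λ { refl → x≢y refl }) , Free-embed⁻ φ f
    Free-embed⁻ (t ∶⟨ X ⟩ φ) m with ∈-map⁻ _ m
    ... | var y , m′ , refl = m′

  Stable-embed : ∀ {D} {a : D} φ → Stable (elem a) (embed φ)
  Stable-embed {a = a} φ =
    ∉elems⇒Stable (embed φ) (subst (a ∉_) (sym (elems-embed φ)) λ ())

  -- A basic formula contains no elements, so every element is stable in it, and substitution
  -- preserves this. It is the form in which being a formula over the domain enters the model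
  -- conditions.
  IsDFormula⇒Stable : ∀ {D} {φ : Fml D} → IsDFormula φ → ∀ a → Stable (elem a) φ
  IsDFormula⇒Stable (ψ , _ , e) a =
    Stable-≈ (≈-sym e) (Stable-[] (embed ψ) (Stable-embed ψ))

  -- Variable bounds and the reading of elements as variables.

  data BelowI (N : ℕ) : Ind ℕ → Set where
    var  : ∀ {x} → x < N → BelowI N (var x)
    -- Elements pass at every `N`; only variables must keep clear of the codes `N + a`.
    elem : ∀ {a} → BelowI N (elem a)

  Below : ℕ → Fml ℕ → Set
  Below N (atom P us)  = ∀ {u} → u ∈ Vec.toList us → BelowI N u
  Below N bot          = ⊤
  Below N (φ ⊃ ψ)      = Below N φ × Below N ψ
  Below N (all x φ)    = x < N × Below N φ
  Below N (t ∶⟨ X ⟩ φ) = (∀ {u} → u ∈ X → BelowI N u) × Below N φ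

  boundL : List (Ind ℕ) → ℕ
  boundL []           = 0
  boundL (var x ∷ X)  = suc x ⊔ boundL X
  boundL (elem a ∷ X) = boundL X

  bound : Fml ℕ → ℕ
  bound (atom P us)  = boundL (Vec.toList us)
  bound bot          = 0
  bound (φ ⊃ ψ)      = bound φ ⊔ bound ψ
  bound (all x φ)    = suc x ⊔ bound φ
  bound (t ∶⟨ X ⟩ φ) = boundL X ⊔ bound φ

  boundL-below : ∀ {N} X → boundL X ≤ N → ∀ {u} → u ∈ X → BelowI N u
  boundL-below (var x ∷ X) le (here refl) = var (m⊔n≤o⇒m≤o (suc x) (boundL X) le)
  boundL-below (var x ∷ X) le (there m)   =
    boundL-below X (m⊔n≤o⇒n≤o (suc x) (boundL X) le) m
  boundL-below (elem a ∷ X) le (here refl) = elem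
  boundL-below (elem a ∷ X) le (there m)   = boundL-below X le m

  bound-below : ∀ {N} φ → bound φ ≤ N → Below N φ
  bound-below (atom P us) le  = boundL-below (Vec.toList us) le
  bound-below bot le          = tt
  bound-below (φ ⊃ ψ) le      =
    bound-below φ (m⊔n≤o⇒m≤o (bound φ) (bound ψ) le) ,
    bound-below ψ (m⊔n≤o⇒n≤o (bound φ) (bound ψ) le)
  bound-below (all x φ) le    =
    m⊔n≤o⇒m≤o (suc x) (bound φ) le ,
    bound-below φ (m⊔n≤o⇒n≤o (suc x) (bound φ) le)
  bound-below (t ∶⟨ X ⟩ φ) le =
    boundL-below X (m⊔n≤o⇒m≤o (boundL X) (bound φ) le) ,
    bound-below φ (m⊔n≤o⇒n≤o (boundL X) (bound φ) le)

  Free⇒BelowI : ∀ {N u} φ → Below N φ → Free u φ → BelowI N u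
  Free⇒BelowI (atom P us) b m             = b (Vec.∈-toList⁺ m)
  Free⇒BelowI (φ ⊃ ψ) (b , b′) (inj₁ f)   = Free⇒BelowI φ b f
  Free⇒BelowI (φ ⊃ ψ) (b , b′) (inj₂ f)   = Free⇒BelowI ψ b′ f
  Free⇒BelowI (all x φ) (_ , b) (_ , f)   = Free⇒BelowI φ b f
  Free⇒BelowI (t ∶⟨ X ⟩ φ) (b , _) m      = b m

  -- Elements are read as variables from N on; for N beyond all variables of φ
  -- this is a faithful copy of φ in the basic language.
  trI : ℕ → Ind ℕ → Ind ⊥
  trI N (var x)  = var x
  trI N (elem a) = var (N + a)

  tr : ℕ → Fml ℕ → Formula
  tr N (atom P us)  = atom P (Vec.map (trI N) us)
  tr N bot          = bot
  tr N (φ ⊃ ψ)      = tr N φ ⊃ tr N ψ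
  tr N (all x φ)    = all x (tr N φ)
  tr N (t ∶⟨ X ⟩ φ) = t ∶⟨ map (trI N) X ⟩ tr N φ

  -- Variables stay below `N` while elements go to `N` and beyond, so the two ranges are disjoint.
  trI-injective : ∀ {N u v} → BelowI N u → BelowI N v → trI N u ≡ trI N v → u ≡ v
  trI-injective (var _)       (var _) refl = refl
  trI-injective {N} (var x<N) elem    refl = contradiction (m≤m+n N _) (<⇒≱ x<N)
  trI-injective {N} elem (var x<N)    refl = contradiction (m≤m+n N _) (<⇒≱ x<N)
  trI-injective {N} elem      elem    e    =
    cong elem (+-cancelˡ-≡ N _ _ (var-injective e))

  tr-embed : ∀ N φ → tr N (embed φ) ≡ φ
  tr-embed N = go
    where
    back : ∀ u → trI N (mapInd ⊥-elim u) ≡ u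
    back (var x) = refl

    go : ∀ φ → tr N (embed φ) ≡ φ
    go (atom P us)  = cong (atom P)
      (trans (sym (Vec.map-∘ _ _ us)) (trans (Vec.map-cong back us) (Vec.map-id us)))
    go bot          = refl
    go (φ ⊃ ψ)      = cong₂ _⊃_ (go φ) (go ψ)
    go (all x φ)    = cong (all x) (go φ)
    go (t ∶⟨ X ⟩ φ) = cong₂ (t ∶⟨_⟩_)
      (trans (sym (List.map-∘ X)) (trans (List.map-cong back X) (List.map-id X))) (go φ)

  tr-≈ : ∀ {N φ ψ} → φ ≈ ψ → tr N φ ≈ tr N ψ
  tr-≈ atom         = atom
  tr-≈ bot          = bot
  tr-≈ (e ⊃ e′)     = tr-≈ e ⊃ tr-≈ e′
  tr-≈ (all e)      = all (tr-≈ e)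
  tr-≈ (just i j e) = just (map⁺ (trI _) i) (map⁺ (trI _) j) (tr-≈ e)

  Free-tr⁻ : ∀ {N w} φ → Free w (tr N φ) → ∃[ u ] Free u φ × w ≡ trI N u
  Free-tr⁻ (atom P us) m = vec-∈-map⁻ _ us m
  Free-tr⁻ (φ ⊃ ψ) (inj₁ f) with Free-tr⁻ φ f
  ... | u , g , e = u , inj₁ g , e
  Free-tr⁻ (φ ⊃ ψ) (inj₂ f) with Free-tr⁻ ψ f
  ... | u , g , e = u , inj₂ g , e
  Free-tr⁻ (all x φ) (w≢x , f) with Free-tr⁻ φ f
  ... | u , g , refl = u , ((λ { refl → w≢x refl }) , g) , refl
  Free-tr⁻ {N} (t ∶⟨ X ⟩ φ) m = ∈-map⁻ (trI N) m

  Free-trI⁻ : ∀ {N u} φ → Below N φ → BelowI N u → Free (trI N u) (tr N φ) → Free u φ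
  Free-trI⁻ φ b bᵤ f with Free-tr⁻ φ f
  ... | v , g , e = subst (λ u → Free u φ)
    (sym (trI-injective bᵤ (Free⇒BelowI φ b g) e)) g

  -- Every quantified variable is below `N`, so none can capture `N + a`.
  Stable-tr : ∀ {N a} φ → Below N φ → Stable (elem a) φ → Stable (var (N + a)) (tr N φ)
  Stable-tr (atom P us) b s = tt
  Stable-tr bot b s = tt
  Stable-tr (φ ⊃ ψ) (b , b′) (s , s′) = Stable-tr φ b s , Stable-tr ψ b′ s′
  Stable-tr {N} (all x φ) (x<N , b) (_ , s) =
    (λ { refl → contradiction (m≤m+n N _) (<⇒≱ x<N) }) , Stable-tr φ b s
  Stable-tr {N} {a} (t ∶⟨ X ⟩ φ) (_ , b) (h , s) =
    (λ f → ∈-map⁺ (trI N) (h (Free-trI⁻ φ b (elem {a = a}) f))) , Stable-tr φ b s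

  -- Variables from `N` on may be images of elements, which substitution leaves alone; hence `σ` has
  -- to fix them.
  tr-[] : ∀ {N} φ {σ} → (∀ y → N ≤ y → σ y ≡ var y) →
          tr N (φ [ σ ]) ≡ tr N φ [ trI N ∘ σ ]
  tr-[] {N} φ {σ} = go φ
    where
    trI-applyI : ∀ {σ} → (∀ y → N ≤ y → σ y ≡ var y) →
                 ∀ u → trI N (applyI σ u) ≡ applyI (trI N ∘ σ) (trI N u)
    trI-applyI fix (var x)  = refl
    trI-applyI fix (elem a) = cong (trI N) (sym (fix (N + a) (m≤m+n N a)))

    go : ∀ φ {σ} → (∀ y → N ≤ y → σ y ≡ var y) → tr N (φ [ σ ]) ≡ tr N φ [ trI N ∘ σ ]
    go (atom P us) fix = cong (atom P)
      (trans (sym (Vec.map-∘ _ _ us)) (trans (Vec.map-cong (trI-applyI fix) us) (Vec.map-∘ _ _ us)))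
    go bot fix = refl
    go (φ ⊃ ψ) fix = cong₂ _⊃_ (go φ fix) (go ψ fix)
    go (all x φ) {σ} fix = cong (all x) (trans (go φ fix′) ([]-cong (tr N φ) λ y _ → eq y))
      where
      fix′ : ∀ y → N ≤ y → (σ ∖ x) y ≡ var y
      fix′ y le with does (x ≟ y)
      ... | true  = refl
      ... | false = fix y le

      eq : ∀ y → trI N ((σ ∖ x) y) ≡ ((trI N ∘ σ) ∖ x) y
      eq y with does (x ≟ y)
      ... | true  = refl
      ... | false = refl
    go (t ∶⟨ X ⟩ φ) {σ} fix = cong₂ (t ∶⟨_⟩_)
      (trans (sym (List.map-∘ X)) (trans (List.map-cong (trI-applyI fix) X) (List.map-∘ X)))
      (trans (go φ fix′) ([]-cong (tr N φ) λ y _ → eq y))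
      where
      fix′ : ∀ y → N ≤ y → (σ ↾ X) y ≡ var y
      fix′ y le with var∈? y X
      ... | yes _ = fix y le
      ... | no _  = refl

      eq : ∀ y → trI N ((σ ↾ X) y) ≡ ((trI N ∘ σ) ↾ map (trI N) X) y
      eq y with var∈? y X
      ... | yes m = sym (↾-∈ (trI N ∘ σ) (∈-map⁺ (trI N) m))
      ... | no ¬m with var∈? y (map (trI N) X)
      ...   | no _ = refl
      ...   | yes m with ∈-map⁻ (trI N) m
      ...     | var x , m′ , refl  = contradiction m′ ¬m
      -- Here `y` is `N + a` for an element `a` listed in `X`: it is in the translated set without
      -- being in `X`, and `σ` fixes it.
      ...     | elem a , _ , refl = cong (trI N) (sym (fix (N + a) (m≤m+n N a)))

  tr-↦ : ∀ {N x a} φ → x < N → tr N (φ [ x ↦ elem a ]) ≡ tr N φ [ x ↦ var (N + a) ]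
  tr-↦ {N} {x} {a} φ x<N = trans
    (tr-[] φ λ y le → ↦-other {x = x} (elem a) λ { refl → <⇒≱ x<N le })
    ([]-cong (tr N φ) λ y _ → eq y)
    where
    eq : ∀ y → trI N ((x ↦ elem a) y) ≡ (x ↦ var (N + a)) y
    eq y with does (x ≟ y)
    ... | true  = refl
    ... | false = refl

-- Enumeration of formulas

-- Terms, lists and formulas all pass through these trees, so that a single injection into ℕ
-- suffices.
data Tree : Set where
  leaf : ℕ → Tree
  node : Tree → Tree → Tree

-- 2ᵃ(2b + 1)
pair : ℕ → ℕ → ℕ
pair zero    b = suc (b + b)
pair (suc a) b = pair a b + pair a b

double-injective : ∀ {m n} → m + m ≡ n + n → m ≡ n
double-injective {m} {n} e = trans (n≡⌊n+n/2⌋ m) (trans (cong ⌊_/2⌋ e) (sym (n≡⌊n+n/2⌋ n)))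

odd≢even : ∀ m n → suc (m + m) ≢ n + n
odd≢even m n e = 1+n≢n (trans e (cong (λ k → k + k) (sym m≡n)))
  where
  m≡n : m ≡ n
  -- Rounding `k / 2` up is by definition rounding `suc k / 2` down, so halving `e` gives the
  -- equality.
  m≡n = trans (n≡⌈n+n/2⌉ m) (trans (cong ⌊_/2⌋ e) (sym (n≡⌊n+n/2⌋ n)))

pair-injective : ∀ a {b} a′ {b′} → pair a b ≡ pair a′ b′ → a ≡ a′ × b ≡ b′
pair-injective zero     zero     e = refl , double-injective (suc-injective e)
pair-injective zero {b} (suc a′) {b′} e = contradiction e (odd≢even b (pair a′ b′))
pair-injective (suc a) {b} zero {b′} e = contradiction (sym e) (odd≢even b′ (pair a b))
pair-injective (suc a)  (suc a′) e with pair-injective a a′ (double-injective e)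
... | refl , e′ = refl , e′

-- Second component 0 marks a leaf, a positive one a node.
codeTree : Tree → ℕ
codeTree (leaf n)   = pair n 0
codeTree (node s t) = pair (codeTree s) (suc (codeTree t))

codeTree-injective : ∀ s t → codeTree s ≡ codeTree t → s ≡ t
codeTree-injective (leaf m) (leaf n) e = cong leaf (proj₁ (pair-injective m n e))
codeTree-injective (leaf m) (node t t′) e with () ← proj₂ (pair-injective m (codeTree t) e)
codeTree-injective (node s s′) (leaf n) e with () ← proj₂ (pair-injective (codeTree s) n e)
codeTree-injective (node s s′) (node t t′) e with pair-injective (codeTree s) (codeTree t) e
... | e₁ , e₂ = cong₂ node (codeTree-injective s t e₁) (codeTree-injective s′ t′ (suc-injective e₂))

encodeTm : Tm → Tree
encodeTm (p i)     = node (leaf 0) (leaf i)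
encodeTm (con i)   = node (leaf 1) (leaf i)
encodeTm (t · s)   = node (leaf 2) (node (encodeTm t) (encodeTm s))
encodeTm (t ⊕ s)   = node (leaf 3) (node (encodeTm t) (encodeTm s))
encodeTm (! t)     = node (leaf 4) (encodeTm t)
encodeTm (⁇ t)     = node (leaf 5) (encodeTm t)
encodeTm (gen x t) = node (leaf 6) (node (leaf x) (encodeTm t))

decodeTm : Tree → Tm
decodeTm (node (leaf 0) (leaf i))          = p i
decodeTm (node (leaf 1) (leaf i))          = con i
decodeTm (node (leaf 2) (node t s))        = decodeTm t · decodeTm s
decodeTm (node (leaf 3) (node t s))        = decodeTm t ⊕ decodeTm s
decodeTm (node (leaf 4) t)                 = ! decodeTm t
decodeTm (node (leaf 5) t)                 = ⁇ decodeTm t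
decodeTm (node (leaf 6) (node (leaf x) t)) = gen x (decodeTm t)
decodeTm _                                 = p 0

decode-encodeTm : ∀ t → decodeTm (encodeTm t) ≡ t
decode-encodeTm (p i)     = refl
decode-encodeTm (con i)   = refl
decode-encodeTm (t · s)   = cong₂ _·_ (decode-encodeTm t) (decode-encodeTm s)
decode-encodeTm (t ⊕ s)   = cong₂ _⊕_ (decode-encodeTm t) (decode-encodeTm s)
decode-encodeTm (! t)     = cong !_ (decode-encodeTm t)
decode-encodeTm (⁇ t)     = cong ⁇_ (decode-encodeTm t)
decode-encodeTm (gen x t) = cong (gen x) (decode-encodeTm t)

encodeInds : List (Ind ℕ) → Tree
encodeInds []           = leaf 0
encodeInds (var x ∷ X)  = node (node (leaf 0) (leaf x)) (encodeInds X)
encodeInds (elem a ∷ X) = node (node (leaf 1) (leaf a)) (encodeInds X)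

decodeInds : Tree → List (Ind ℕ)
decodeInds (node (node (leaf 0) (leaf x)) t) = var x ∷ decodeInds t
decodeInds (node (node (leaf 1) (leaf a)) t) = elem a ∷ decodeInds t
decodeInds _                                 = []

decode-encodeInds : ∀ X → decodeInds (encodeInds X) ≡ X
decode-encodeInds []           = refl
decode-encodeInds (var x ∷ X)  = cong (var x ∷_) (decode-encodeInds X)
decode-encodeInds (elem a ∷ X) = cong (elem a ∷_) (decode-encodeInds X)

-- Short lists are padded with a junk entry.
listToVec : ∀ n → List (Ind ℕ) → Vec (Ind ℕ) n
listToVec zero    X       = []
listToVec (suc n) []      = var 0 ∷ listToVec n []
listToVec (suc n) (u ∷ X) = u ∷ listToVec n X

listToVec-toList : ∀ {n} (us : Vec (Ind ℕ) n) → listToVec n (Vec.toList us) ≡ us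
listToVec-toList []       = refl
listToVec-toList (u ∷ us) = cong (u ∷_) (listToVec-toList us)

module Enumeration (em : ExcludedMiddle 0ℓ) (S : Signature) where
  open FOJT45 S

  -- `code` comes without an inverse, so whether a number is the code of a predicate is settled by
  -- excluded middle and passed in as an argument.
  decodeAtom : ∀ {n} → Dec (∃[ P ] code P ≡ n) → Tree → Fml ℕ
  decodeAtom (yes (P , _)) t = atom P (listToVec (arity P) (decodeInds t))
  decodeAtom (no _)        t = bot

  encode : Fml ℕ → Tree
  encode (atom P us)  = node (leaf 0) (node (leaf (code P)) (encodeInds (Vec.toList us)))
  encode bot          = leaf 0
  encode (φ ⊃ ψ)      = node (leaf 1) (node (encode φ) (encode ψ))
  encode (all x φ)    = node (leaf 2) (node (leaf x) (encode φ))
  encode (t ∶⟨ X ⟩ φ) = node (leaf 3) (node (encodeTm t) (node (encodeInds X) (encode φ)))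

  decode : Tree → Fml ℕ
  decode (node (leaf 0) (node (leaf n) t))          = decodeAtom (em {∃[ P ] code P ≡ n}) t
  decode (node (leaf 1) (node s t))                 = decode s ⊃ decode t
  decode (node (leaf 2) (node (leaf x) t))          = all x (decode t)
  decode (node (leaf 3) (node s (node t u)))        = decodeTm s ∶⟨ decodeInds t ⟩ decode u
  decode _                                          = bot

  decode-encode : ∀ φ → decode (encode φ) ≡ φ
  decode-encode (atom P us) with em {∃[ Q ] code Q ≡ code P}
  ... | no none = contradiction (P , refl) none
  ... | yes (Q , e) with code-injective e
  ...   | refl = cong (atom P)
    (trans (cong (listToVec _) (decode-encodeInds (Vec.toList us))) (listToVec-toList us))
  decode-encode bot          = refl
  decode-encode (φ ⊃ ψ)      = cong₂ _⊃_ (decode-encode φ) (decode-encode ψ)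
  decode-encode (all x φ)    = cong (all x) (decode-encode φ)
  decode-encode (t ∶⟨ X ⟩ φ)
    rewrite decode-encodeTm t | decode-encodeInds X | decode-encode φ = refl

  enumerate : ℕ → Fml ℕ
  enumerate n with em {∃[ t ] codeTree t ≡ n}
  ... | yes (t , _) = decode t
  ... | no _        = bot

  enumerate-surjective : ∀ φ → ∃[ n ] enumerate n ≡ φ
  enumerate-surjective φ = codeTree (encode φ) , eq
    where
    eq : enumerate (codeTree (encode φ)) ≡ φ
    eq with em {∃[ t ] codeTree t ≡ codeTree (encode φ)}
    ... | no none     = contradiction (encode φ , refl) none
    ... | yes (t , e) = trans (cong decode (codeTree-injective t (encode φ) e)) (decode-encode φ)

-- Provability and Henkin sets

module Propositional (S : Signature) where
  open FOJT45 S

  -- The same propositional reasoning serves three sets: derivable formulas, theorems with elements,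
  -- and the Henkin set.
  record IsClassical {D : Set} (T : Fml D → Set) : Set where
    field
      detach : ∀ {φ ψ} → T (φ ⊃ ψ) → T φ → T ψ
      axK    : ∀ {φ ψ} → T (φ ⊃ ψ ⊃ φ)
      axS    : ∀ {φ ψ χ} → T ((φ ⊃ ψ ⊃ χ) ⊃ (φ ⊃ ψ) ⊃ φ ⊃ χ)
      axN    : ∀ {φ} → T (neg (neg φ) ⊃ φ)

    const : ∀ {φ ψ} → T ψ → T (φ ⊃ ψ)
    const = detach axK

    app : ∀ {φ ψ χ} → T (φ ⊃ ψ ⊃ χ) → T (φ ⊃ ψ) → T (φ ⊃ χ)
    app h k = detach (detach axS h) k

    identity : ∀ {φ} → T (φ ⊃ φ)
    identity {φ} = app axK (axK {ψ = φ})

    compose : ∀ {φ ψ χ} → T (φ ⊃ ψ) → T (ψ ⊃ χ) → T (φ ⊃ χ)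
    compose h k = app (const k) h

    post : ∀ {φ ψ χ} → T (ψ ⊃ χ) → T ((φ ⊃ ψ) ⊃ φ ⊃ χ)
    post h = detach axS (const h)

    pre : ∀ {φ ψ χ} → T (φ ⊃ ψ) → T ((ψ ⊃ χ) ⊃ φ ⊃ χ)
    pre h = app (compose axK axS) (const h)

    absurd : ∀ {φ} → T (bot ⊃ φ)
    absurd = compose axK axN

    -- `neg (φ ⊃ neg ψ)` is classical conjunction: if either conjunct failed, `φ ⊃ neg ψ` would
    -- hold.
    and₁ : ∀ {φ ψ} → T (neg (φ ⊃ neg ψ) ⊃ φ)
    and₁ = compose (pre (post absurd)) axN

    and₂ : ∀ {φ ψ} → T (neg (φ ⊃ neg ψ) ⊃ ψ)
    and₂ = compose (pre axK) axN

module Provability (em : ExcludedMiddle 0ℓ) (S : Signature)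
                   (CS : FOJT45.ConstantSpecification S) where
  open FOJT45 S
  open Syntax S
  open Propositional S

  -- Derivability in the basic language and theorems with elements.

  ⊢-classical : IsClassical (CS ⊢_)
  ⊢-classical = record { detach = mp ; axK = ax A1-K ; axS = ax A1-S ; axN = ax A1-N }

  module ⊢ = IsClassical ⊢-classical

  -- The usual derivation of `φ ⊃ φ` from A1-S and two instances of A1-K, with the last `φ` of the
  -- A1-S instance exchanged for `ψ`.
  ⊢-≈ : ∀ {φ ψ} → φ ≈ ψ → CS ⊢ φ ⊃ ψ
  ⊢-≈ {φ} e =
    mp (mp (ax (≈-ax (≈-refl ⊃ (≈-refl ⊃ (≈-refl ⊃ e))) A1-S)) (ax A1-K)) (ax (A1-K {ψ = φ}))

  -- A3 adds only a new individual; a repeated one leaves the set as it is, and `≈` takes care of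
  -- the list.
  ⊢-weaken : ∀ {t φ X} Z → CS ⊢ t ∶⟨ X ⟩ φ ⊃ t ∶⟨ Z ++ X ⟩ φ
  ⊢-weaken [] = ⊢.identity
  ⊢-weaken {X = X} (z ∷ Z) with em {z ∈ Z ++ X}
  ... | yes m = ⊢.compose (⊢-weaken Z)
    (⊢-≈ (just there (λ { (here refl) → m ; (there n) → n }) ≈-refl))
  ... | no ¬m = ⊢.compose (⊢-weaken Z) (ax (A3 ¬m))

  ⊢-strengthen : ∀ {t φ X} Z → (∀ {u} → u ∈ Z → Free u φ → u ∈ X) →
                 CS ⊢ t ∶⟨ Z ++ X ⟩ φ ⊃ t ∶⟨ X ⟩ φ
  ⊢-strengthen [] h = ⊢.identity
  ⊢-strengthen {X = X} (z ∷ Z) h with em {z ∈ Z ++ X}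
  ... | yes m = ⊢.compose
    (⊢-≈ (just (λ { (here refl) → m ; (there n) → n }) there ≈-refl))
    (⊢-strengthen Z (h ∘ there))
  ... | no ¬m = ⊢.compose
    -- If `z` were free in `φ` it would be kept in `X`, against its being new.
    (ax (A2 ¬m λ f → ¬m (∈-++⁺ʳ Z (h (here refl) f))))
    (⊢-strengthen Z (h ∘ there))

  -- First `Y` is added, then `X` is dropped: its members that are free in `φ` survive as members of
  -- `Y`.
  ⊢-adjust : ∀ {t φ X Y} → (∀ {u} → u ∈ X → Free u φ → u ∈ Y) →
             CS ⊢ t ∶⟨ X ⟩ φ ⊃ t ∶⟨ Y ⟩ φ
  ⊢-adjust {X = X} {Y} h =
    ⊢.compose (⊢-weaken Y)
      (⊢.compose (⊢-≈ (just (swap Y) (swap X) ≈-refl)) (⊢-strengthen X h))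
    where
    swap : ∀ {u} A {B : List (Ind ⊥)} → u ∈ A ++ B → u ∈ B ++ A
    swap A {B} m = [ ∈-++⁺ʳ B , ∈-++⁺ˡ ]′ (∈-++⁻ A m)

  -- Asking for derivability of tr N δ at all large N makes theorems closed under
  -- modus ponens and lets every new element denote a fresh variable.
  record Theorem (δ : Fml ℕ) : Set where
    constructor theorem-from
    field
      threshold : ℕ
      derivable : ∀ N → threshold ≤ N → CS ⊢ tr N δ

  always : ∀ {δ} → (∀ N → CS ⊢ tr N δ) → Theorem δ
  always h = theorem-from 0 λ N _ → h N

  -- `χ` is any formula carrying the variables that the derivation wants below `N`; it may differ
  -- from `δ`.
  eventually : ∀ {δ} χ → (∀ N → Below N χ → CS ⊢ tr N δ) → Theorem δ
  eventually χ h = theorem-from (bound χ) λ N le → h N (bound-below χ le)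

  eventually₁ : ∀ {δ ε} χ → (∀ N → Below N χ → CS ⊢ tr N δ → CS ⊢ tr N ε) →
                Theorem δ → Theorem ε
  eventually₁ χ h (theorem-from M k) = theorem-from (M ⊔ bound χ) λ N le →
    h N (bound-below χ (m⊔n≤o⇒n≤o M (bound χ) le)) (k N (m⊔n≤o⇒m≤o M (bound χ) le))

  Thm-classical : IsClassical Theorem
  Thm-classical = record
    { detach = λ { (theorem-from M h) (theorem-from M′ k) → theorem-from (M ⊔ M′) λ N le →
               mp (h N (m⊔n≤o⇒m≤o M M′ le)) (k N (m⊔n≤o⇒n≤o M M′ le)) }
    ; axK    = always λ N → ax A1-K
    ; axS    = always λ N → ax A1-S
    ; axN    = always λ N → ax A1-N
    }

  module Thm = IsClassical Thm-classical

  Thm-≈ : ∀ {φ ψ} → φ ≈ ψ → Theorem (φ ⊃ ψ)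
  Thm-≈ e = always λ N → ⊢-≈ (tr-≈ e)

  Thm-adjust : ∀ {t φ X Y} → (∀ {u} → u ∈ X → Free u φ → u ∈ Y) →
               Theorem (t ∶⟨ X ⟩ φ ⊃ t ∶⟨ Y ⟩ φ)
  Thm-adjust {t} {φ} {X} {Y} h = eventually (t ∶⟨ X ⟩ φ) λ N (bX , b) → ⊢-adjust (h′ N bX b)
    where
    h′ : ∀ N → (∀ {u} → u ∈ X → BelowI N u) → Below N φ →
         ∀ {u} → u ∈ map (trI N) X → Free u (tr N φ) → u ∈ map (trI N) Y
    h′ N bX b m f with ∈-map⁻ (trI N) m
    ... | v , v∈X , refl = ∈-map⁺ (trI N) (h v∈X (Free-trI⁻ φ b (bX v∈X) f))

  Thm-gnl : ∀ {x γ δ} → ¬ Free (var x) γ → Theorem (γ ⊃ δ) → Theorem (γ ⊃ all x δ)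
  Thm-gnl {x} {γ} ¬f = eventually₁ (all x γ) λ N (x<N , b) h →
    mp (ax (A1-D λ f → ¬f (Free-trI⁻ γ b (var x<N) f))) (gnl h)

  Thm-inst : ∀ {x a ψ} → Stable (elem a) ψ → Theorem (all x ψ ⊃ ψ [ x ↦ elem a ])
  Thm-inst {x} {a} {ψ} s = eventually (all x ψ) λ N (x<N , b) →
    subst (λ χ → CS ⊢ all x (tr N ψ) ⊃ χ) (sym (tr-↦ ψ x<N))
      (ax (A1-I (FreeFor-↦ (tr N ψ) x (Stable-tr ψ b s))))

  -- Since `z` is new to `ψ`, instantiating it by `x` gives `ψ` back; `x` is not free in the
  -- premise, so it can then be generalized.
  ⊢-rename : ∀ {x z ψ} → x ≢ z → Stable (var z) ψ → ¬ Free (var z) ψ →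
             CS ⊢ all z (ψ [ x ↦ var z ]) ⊃ all x ψ
  ⊢-rename {x} {z} {ψ} x≢z s ¬f =
    mp (ax (A1-D x-bound)) (gnl (subst (λ χ → CS ⊢ all z (ψ [ x ↦ var z ]) ⊃ χ) back
      (ax (A1-I (FreeFor-leftInverse ψ freeFor inverse)))))
    where
    freeFor : FreeFor (x ↦ var z) ψ
    freeFor = FreeFor-↦ ψ x s

    inverse : ∀ v → Free (var v) ψ → applyI (z ↦ var x) ((x ↦ var z) v) ≡ var v
    inverse v f with does (x ≟ v) | proof (x ≟ v)
    ... | true  | ofʸ refl = ↦-same z (var x)
    ... | false | ofⁿ _    = ↦-other {x = z} (var x) λ { refl → ¬f f }

    back : ψ [ x ↦ var z ] [ z ↦ var x ] ≡ ψ
    back = trans ([]-∘ ψ freeFor) ([]-id ψ inverse)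

    x-bound : ¬ Free (var x) (all z (ψ [ x ↦ var z ]))
    x-bound (_ , f) with Free-[]⁻ ψ f
    ... | var v , _ , e with does (x ≟ v) | proof (x ≟ v)
    ...   | true  | ofʸ _  = x≢z (var-injective e)
    ...   | false | ofⁿ x≢v = x≢v (var-injective e)

  -- The element `a` is read as the variable `N + a`, free in neither translation; it is generalized
  -- and the bound variable renamed to `x`.
  Thm-genElem : ∀ {x a γ ψ} → a ∉ elems γ → a ∉ elems ψ →
                Theorem (γ ⊃ ψ [ x ↦ elem a ]) → Theorem (γ ⊃ all x ψ)
  Thm-genElem {x} {a} {γ} {ψ} a∉γ a∉ψ = eventually₁ (γ ⊃ all x ψ) λ N (bγ , x<N , bψ) h →
    ⊢.compose
      (mp (ax (A1-D λ f → a∉γ (Free-elem⇒∈elems γ (Free-trI⁻ γ bγ elem f))))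
          (gnl (subst (λ χ → CS ⊢ tr N γ ⊃ χ) (tr-↦ ψ x<N) h)))
      (⊢-rename (λ { refl → <⇒≱ x<N (m≤m+n N a) })
        (Stable-tr ψ bψ (∉elems⇒Stable ψ a∉ψ))
        (λ f → a∉ψ (Free-elem⇒∈elems ψ (Free-trI⁻ ψ bψ elem f))))

  -- The model reads evidence at the set of all elements of a formula, whereas the axioms relate
  -- formulas over one common set. `into` and `own` pass between the two.
  into : ∀ {t φ Y} → (∀ {a} → Free (elem a) φ → elem a ∈ Y) → Theorem (t ∶ φ ⊃ t ∶⟨ Y ⟩ φ)
  into h = Thm-adjust λ m f → case-elem m f
    where
    case-elem : ∀ {u} → u ∈ map elem _ → Free u _ → u ∈ _
    case-elem m f with ∈-map⁻ elem m
    ... | a , _ , refl = h f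

  own : ∀ {t φ} X → Theorem (t ∶⟨ map elem X ⟩ φ ⊃ t ∶ φ)
  own {t} {φ} X = Thm-adjust own-∈
    where
    own-∈ : ∀ {u} → u ∈ map elem X → Free u φ → u ∈ map elem (elems φ)
    own-∈ m f with ∈-map⁻ elem m
    ... | a , _ , refl = ∈-map⁺ elem (Free-elem⇒∈elems φ f)

  var∉elems : ∀ {D x} (X : List D) → var x ∉ map Ind.elem X
  var∉elems X m with ∈-map⁻ elem m
  ... | _ , _ , ()

  evidence-inst : ∀ {t φ x a} → Stable (elem a) φ → Theorem (t ∶ φ ⊃ t ∶ (φ [ x ↦ elem a ]))
  evidence-inst {t} {φ} {x} {a} s =
    Thm.compose generalized (Thm.compose instantiated (Thm-adjust instance-∈))
    where
    X : List (Ind ℕ)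
    X = var x ∷ map elem (elems φ)

    -- As `x` is in `X`, the substitution reaches the body unrestricted.
    eq : ∀ y → ((x ↦ elem a) ↾ X) y ≡ (x ↦ elem a) y
    eq y with var∈? y X
    ... | yes m = ↾-∈ (x ↦ elem a) m
    ... | no ¬m = trans (↾-∉ (x ↦ elem a) ¬m)
      (sym (↦-other {x = x} (elem a) λ { refl → ¬m (here refl) }))

    generalized : Theorem (t ∶ φ ⊃ all x (t ∶⟨ X ⟩ φ))
    generalized = Thm-gnl (var∉elems (elems φ)) (Thm-adjust λ m _ → there m)

    instantiated : Theorem (all x (t ∶⟨ X ⟩ φ) ⊃
                        t ∶⟨ map (applyI (x ↦ elem a)) X ⟩ (φ [ x ↦ elem a ]))
    instantiated = subst
      (λ χ → Theorem (all x (t ∶⟨ X ⟩ φ) ⊃ t ∶⟨ map (applyI (x ↦ elem a)) X ⟩ χ))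
      ([]-cong φ λ y _ → eq y)
      -- `X` lists every element of `φ`, so `a` is not captured even if it already occurs there.
      (Thm-inst {ψ = t ∶⟨ X ⟩ φ} ((λ f → there (∈-map⁺ elem (Free-elem⇒∈elems φ f))) , s))

    instance-∈ : ∀ {u} → u ∈ map (applyI (x ↦ elem a)) X → Free u (φ [ x ↦ elem a ]) →
                 u ∈ map elem (elems (φ [ x ↦ elem a ]))
    instance-∈ {elem b} _ f = ∈-map⁺ elem (Free-elem⇒∈elems (φ [ x ↦ elem a ]) f)
    instance-∈ {var y} m f with ∈-map⁻ (applyI (x ↦ elem a)) m
    ... | elem b , _ , ()
    ... | var v , there m′ , _ = contradiction m′ (var∉elems (elems φ))
    ... | var v , here refl , e with () ← trans e (↦-same x (elem a))

  -- Consistent extensions with Henkin witnesses.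

  infixl 7 _∧_
  _∧_ : Fml ℕ → Fml ℕ → Fml ℕ
  φ ∧ ψ = neg (φ ⊃ neg ψ)

  -- A finite consistent set of formulas, folded into one conjunction.
  Stage : Set
  Stage = Σ (Fml ℕ) λ γ → ¬ Theorem (neg γ)

  -- The last component is the Henkin witness: a refuted universal formula has a refuted instance.
  Settled : Fml ℕ → Fml ℕ → Set
  Settled γ δ = Theorem (γ ⊃ δ) ⊎
    (Theorem (γ ⊃ neg δ) ×
     (∀ x ψ → δ ≡ all x ψ → ∃[ a ] Theorem (γ ⊃ neg (ψ [ x ↦ elem a ]))))

  -- Unfolded, the assumed theorem is the double negation of `γ ⊃ neg (neg δ)`; removing both double
  -- negations derives `γ ⊃ δ`.
  ∧-consistent : ∀ {γ δ} → ¬ Theorem (γ ⊃ δ) → ¬ Theorem (neg (γ ∧ neg δ))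
  ∧-consistent n h = n (Thm.compose (Thm.detach Thm.axN h) Thm.axN)

  settle : ∀ (γ : Stage) δ → Σ Stage λ γ′ → Theorem (proj₁ γ′ ⊃ proj₁ γ) × Settled (proj₁ γ′) δ
  settle γ@(γ₀ , _) δ with em {Theorem (γ₀ ⊃ δ)}
  ... | yes h = γ , Thm.identity , inj₁ h
  ... | no n with em {∃[ x ] ∃[ ψ ] δ ≡ all x ψ}
  ...   | no none =
    (γ₀ ∧ neg δ , ∧-consistent n) , Thm.and₁ ,
    inj₂ (Thm.and₂ , λ x ψ e → contradiction (x , ψ , e) none)
  ...   | yes (x , ψ , refl) =
    (γ₁ ∧ neg (ψ [ x ↦ elem a ]) , ∧-consistent unprovable) ,
    Thm.compose Thm.and₁ Thm.and₁ ,
    inj₂ (Thm.compose Thm.and₁ Thm.and₂ , λ { _ _ refl → a , Thm.and₂ })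
    where
    γ₁ : Fml ℕ
    γ₁ = γ₀ ∧ neg (all x ψ)

    a : ℕ
    a = proj₁ (fresh (elems γ₁ ++ elems ψ))

    a-fresh : a ∉ elems γ₁ ++ elems ψ
    a-fresh = proj₂ (fresh (elems γ₁ ++ elems ψ))

    -- By freshness of `a`, a derivable instance would generalize to `all x ψ`, which `γ₁` also
    -- refutes, so `γ₁` would be inconsistent.
    unprovable : ¬ Theorem (γ₁ ⊃ ψ [ x ↦ elem a ])
    unprovable h = ∧-consistent n (Thm.app Thm.and₂
      (Thm-genElem (a-fresh ∘ ∈-++⁺ˡ) (a-fresh ∘ ∈-++⁺ʳ (elems γ₁)) h))

  -- The maximal consistent set with witnesses.

  module Henkin (start : Stage) where
    open Enumeration em S

    stage : ℕ → Stage
    stage zero    = start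
    stage (suc n) = proj₁ (settle (stage n) (enumerate n))

    stage-mono : ∀ m k → Theorem (proj₁ (stage (k + m)) ⊃ proj₁ (stage m))
    stage-mono m zero    = Thm.identity
    stage-mono m (suc k) =
      Thm.compose (proj₁ (proj₂ (settle (stage (k + m)) (enumerate (k + m))))) (stage-mono m k)

    -- The deductive closure of the increasing sequence of stages.
    Γ : Fml ℕ → Set
    Γ δ = ∃[ n ] Theorem (proj₁ (stage n) ⊃ δ)

    Γ-thm : ∀ {δ} → Theorem δ → Γ δ
    Γ-thm h = 0 , Thm.const h

    Γ-classical : IsClassical Γ
    Γ-classical = record
      -- Stage `n + m` proves what both earlier stages prove; commutativity aligns the index for the
      -- second.
      { detach = λ { (m , h) (n , k) → n + m , Thm.app
          (Thm.compose (stage-mono m n) h)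
          (Thm.compose
            (subst (λ i → Theorem (proj₁ (stage i) ⊃ proj₁ (stage n))) (+-comm m n) (stage-mono n m))
            k) }
      ; axK    = Γ-thm Thm.axK
      ; axS    = Γ-thm Thm.axS
      ; axN    = Γ-thm Thm.axN
      }

    open IsClassical Γ-classical public

    Γ-⊃ : ∀ {δ ε} → Theorem (δ ⊃ ε) → Γ δ → Γ ε
    Γ-⊃ h = detach (Γ-thm h)

    Γ-start : Γ (proj₁ start)
    Γ-start = 0 , Thm.identity

    Γ-consistent : ¬ Γ bot
    Γ-consistent (n , h) = proj₂ (stage n) h

    -- Every `δ` is `enumerate n` for some `n`, and stage `suc n` settles it.
    Γ-settled : ∀ δ → Γ δ ⊎
      (Γ (neg δ) × (∀ x ψ → δ ≡ all x ψ → ∃[ a ] Γ (neg (ψ [ x ↦ elem a ]))))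
    Γ-settled δ with enumerate-surjective δ
    ... | n , refl with proj₂ (proj₂ (settle (stage n) (enumerate n)))
    ...   | inj₁ h       = inj₁ (suc n , h)
    ...   | inj₂ (h , w) = inj₂ ((suc n , h) , λ x ψ e → proj₁ (w x ψ e) , suc n , proj₂ (w x ψ e))

    Γ-neg : ∀ {δ} → ¬ Γ δ → Γ (neg δ)
    Γ-neg {δ} n with Γ-settled δ
    ... | inj₁ h       = contradiction h n
    ... | inj₂ (h , _) = h

    Γ-⊃-intro : ∀ {δ ε} → (Γ δ → Γ ε) → Γ (δ ⊃ ε)
    Γ-⊃-intro {δ} h with Γ-settled δ
    ... | inj₁ k       = const (h k)
    ... | inj₂ (k , _) = detach (post absurd) k

    -- Otherwise the Henkin witness is an instance in `Γ` together with its negation.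
    Γ-all-intro : ∀ {x ψ} → (∀ a → Γ (ψ [ x ↦ elem a ])) → Γ (all x ψ)
    Γ-all-intro {x} {ψ} h with Γ-settled (all x ψ)
    ... | inj₁ k       = k
    ... | inj₂ (_ , w) with w x ψ refl
    ...   | a , k = contradiction (detach k (h a)) Γ-consistent

  -- The canonical model

  module Model (start : Stage) where
    open Henkin start

    structure : Structure
    structure = record
      { W = ⊤
      ; R = λ _ _ → ⊤
      ; D = ℕ
      ; I = λ P _ as → Γ (atom P (Vec.map elem as))
      ; E = λ t φ _ → Γ (t ∶ φ)
      }

    open Structure structure using (Truth; _⊩_)

    -- B1 is applied only after all variables have been instantiated inside the
    -- justified formula, one at a time.
    Γ-instances : ∀ {t φ} → (∀ a → Stable (elem a) φ) → Γ (t ∶ φ) →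
                  ∀ as → Γ (φ [ elem ∘ as ])
    Γ-instances {t} {φ} s h as =
      subst Γ ([]-cong φ final) (Γ-⊃ (always λ N → ax B1) (iterate (bound φ)))
      where
      iterate : ∀ k → Γ (t ∶ (φ [ upto as k ]))
      iterate zero    = subst (λ χ → Γ (t ∶ χ)) (sym ([]-id φ λ y _ → refl)) h
      iterate (suc k) = subst (λ χ → Γ (t ∶ χ))
        (trans ([]-∘ φ (FreeFor-upto s as k)) ([]-cong φ λ y _ → upto-suc as k y))
        (Γ-⊃ (evidence-inst {x = k} (Stable-[] φ (s (as k)))) (iterate k))

      final : ∀ y → Free (var y) φ → upto as (bound φ) y ≡ elem (as y)
      final y f with Free⇒BelowI φ (bound-below φ ≤-refl) f
      ... | var y<k = upto-< as y<k

    -- The recursion follows the shape, as instances of `all x φ` are not subterms. Closedness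
    -- leaves only elements in atoms, stability licenses instantiation by elements, and the two
    -- together let `t ∶⟨ X ⟩ φ` and `t ∶ φ` be exchanged.
    truth : ∀ s φ → shape φ ≡ s → Closed φ → (∀ a → Stable (elem a) φ) →
            Truth s tt φ ⇔ Γ φ
    truth leaf (atom P us) _ c _ = mk⇔
      (λ { (as , refl , h) → h })
      (λ h → let as , e = all-elem us c in as , e , subst (λ vs → Γ (atom P vs)) e h)
    truth leaf bot _ _ _ = mk⇔ (λ ()) Γ-consistent
    truth (bin r r′) (φ ⊃ ψ) e c s = mk⇔
      (λ h → Γ-⊃-intro (to IHψ ∘ h ∘ from IHφ))
      (λ h → from IHψ ∘ detach h ∘ to IHφ)
      where
      open Equivalence
      IHφ = truth r φ (proj₁ (bin-injective e)) (λ x → c x ∘ inj₁) (proj₁ ∘ s)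
      IHψ = truth r′ ψ (proj₂ (bin-injective e)) (λ x → c x ∘ inj₂) (proj₂ ∘ s)
    truth (un r) (all x φ) e c s = mk⇔
      (λ h → Γ-all-intro λ a → to (IH a) (h a))
      (λ h a → from (IH a) (Γ-⊃ (Thm-inst {x} (proj₂ (s a))) h))
      where
      open Equivalence
      IH : ∀ a → Truth r tt (φ [ x ↦ elem a ]) ⇔ Γ (φ [ x ↦ elem a ])
      IH a = truth r (φ [ x ↦ elem a ]) (trans (shape-[] φ _) (un-injective e)) (Closed-↦ c a)
        (λ b → Stable-[] φ (proj₂ (s b)))
    truth (un r) (t ∶⟨ X ⟩ φ) e c s = mk⇔
      -- Evidence is membership of `t ∶ φ` in `Γ`; stability puts the free elements of `φ` into `X`.
      (λ (h , _) → Γ-⊃ (into (proj₁ (s _))) h)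
      (λ h → evidence h , λ _ _ as → from (IH as) (Γ-instances (proj₂ ∘ s) (evidence h) as))
      where
      open Equivalence
      IH : ∀ as → Truth r tt (φ [ elem ∘ as ]) ⇔ Γ (φ [ elem ∘ as ])
      IH as = truth r (φ [ elem ∘ as ]) (trans (shape-[] φ _) (un-injective e)) (Closed-elem φ as)
        (λ b → Stable-[] φ (proj₂ (s b)))

      own-∈ : ∀ {u} → u ∈ X → Free u φ → u ∈ map elem (elems φ)
      own-∈ {var x}  m f = contradiction m (c x)
      own-∈ {elem a} m f = ∈-map⁺ elem (Free-elem⇒∈elems φ f)

      evidence : Γ (t ∶⟨ X ⟩ φ) → Γ (t ∶ φ)
      evidence = Γ-⊃ (Thm-adjust own-∈)

    ⊩⇔Γ : ∀ {φ} → Closed φ → (∀ a → Stable (elem a) φ) → (tt ⊩ φ) ⇔ Γ φ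
    ⊩⇔Γ {φ} = truth (shape φ) φ refl

    model : FittingModel
    model = record
      { structure = structure
      ; world     = tt
      ; element   = 0
      ; R-equiv   = record { refl = tt ; sym = λ _ → tt ; trans = λ _ _ → tt }
      ; E-resp    = λ _ e → Γ-⊃ (Thm-≈
          (just (map⁺ elem (elems-≈ e)) (map⁺ elem (elems-≈ (≈-sym e))) e))
      -- B2 wants one set for both premises: the elements of `φ ⊃ ψ`. The result is then trimmed to
      -- those of `ψ`.
      ; E-app     = λ {_} {_} {φ} {ψ} _ h k → Γ-⊃ (own (elems (φ ⊃ ψ)))
          (detach (detach (Γ-thm (always λ N → ax B2)) h)
            (Γ-⊃ (into λ f → ∈-map⁺ elem (∈-++⁺ˡ (Free-elem⇒∈elems φ f))) k))
      ; E-sum     = λ _ → [ Γ-⊃ (always λ N → ax B3ˡ) , Γ-⊃ (always λ N → ax B3ʳ) ]′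
      -- B4 is applied at the given `X`, reached from the elements of `φ`.
      ; E-bang    = λ {_} {φ} _ X i h → Γ-⊃ (own X)
          (Γ-⊃ (always λ N → ax B4) (Γ-⊃ (into λ f → ∈-map⁺ elem (i (Free-elem⇒∈elems φ f))) h))
      ; E-R       = λ _ _ h → h
      ; E-inst    = λ d x a → Γ-⊃ (evidence-inst {x = x} (IsDFormula⇒Stable d a))
      -- `all x bot` keeps `x` below `N`, hence distinct from every `N + a`, as B5 requires.
      ; E-gen     = λ {t} {φ} _ x → Γ-⊃ (eventually (all x bot) λ N (x<N , _) →
          ax (B5 (x∉ N x<N (elems φ))))
      ; E-strong  = λ {t} {φ} d h → Equivalence.from
          (⊩⇔Γ {t ∶ φ} (λ x → var∉elems (elems φ))
            (λ a → (λ f → ∈-map⁺ elem (Free-elem⇒∈elems φ f)) , IsDFormula⇒Stable d a)) h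
      -- Maximality turns missing evidence into `neg (t ∶ φ)` in `Γ`, to which B6 applies.
      ; E-query   = λ {t} {φ} _ n → Γ-⊃ (own (elems φ)) (Γ-⊃ (always λ N → ax B6) (Γ-neg n))
      }
      where
      x∉ : ∀ {x} N → x < N → ∀ X → var x ∉ map (trI N) (map elem X)
      x∉ N x<N X m with ∈-map⁻ (trI N) m
      ... | u , m′ , e with ∈-map⁻ elem m′
      ...   | a , _ , refl with refl ← e = <⇒≱ x<N (m≤m+n N a)

    -- `embed φ` has no elements, so the set attached to the constant is empty and translation gives
    -- back `φ`: the added axiom itself is what `Γ` has to contain.
    meets : Meets model CS
    meets c φ h _ = Γ-thm (always λ N → subst
      (λ X → CS ⊢ con c ∶⟨ map (trI N) (map elem X) ⟩ tr N (embed φ)) (sym (elems-embed φ))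
      (subst (λ χ → CS ⊢ con c ∶⟨ [] ⟩ χ) (sym (tr-embed N φ)) (cs h)))

mainTheorem7 : ExcludedMiddle 0ℓ → (S : Signature) → let open FOJT45 S in
    (CS : ConstantSpecification) → VariantClosed CS → AxiomaticallyAppropriate CS →
    (φ : Formula) → Closed φ →
    ((M : FittingModel) → Meets M CS → ValidIn M φ) →
    CS ⊢ φ
mainTheorem7 em S CS _ _ φ closed valid with em {FOJT45._⊢_ S CS φ}
... | yes h = h
-- The canonical model built from `neg (embed φ)` satisfies `embed φ` by validity, so `Γ` contains
-- both.
... | no ⊬φ = contradiction
  (detach Γ-start (Equivalence.to
    (⊩⇔Γ (Closed-embed {ℕ} φ closed) (λ a → Stable-embed {a = a} φ)) (valid model meets tt)))
  Γ-consistent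
  where
  open FOJT45 S
  open Syntax S
  open Provability em S CS

  start : Stage
  -- Read at its own threshold, a refutation of `neg (embed φ)` is a derivation of the double
  -- negation of `φ`.
  start = neg (embed φ) , λ (theorem-from N h) →
    ⊬φ (mp (ax A1-N) (subst (λ χ → CS ⊢ neg (neg χ)) (tr-embed N φ) (h N ≤-refl)))

  open Henkin start
  open Model start
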